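{- The following (randomized) non-adaptive algorithm is $8$-competitive for graphic matroid prophet inequalities, i.e., on every graphic matroid prophet inequality instance given by a graph $G=(V,E)$ and variables $(X_e)_{e\in E}$ it satisfies $\mathbb{E}[\mathrm{OPT}]\le 8\cdot\mathbb{E}[\mathrm{ALG}]$. The algorithm: let $A\subseteq V$ be a random subset that includes each vertex independently with probability $1/2$, and let $B=V\setminus A$. For each $v\in B$, compute $T_v$ such that $\Pr\left[\max_{e=(v,u),\,u\in A}X_e\ge T_v\right]=1/2$, and set $T_e=T_v$ for each edge $e=(v,u)$ with $u\in A$. For every edge $e$ with both endpoints in $A$ or both endpoints in $B$, set $T_e=+\infty$. Then run the non-adaptive algorithm with thresholds $(T_e)_{e\in E}$.
   Context: Graphic matroid prophet inequality instance: a finite graph $G=(V,E)$ (parallel edges allowed) and independent nonnegative random variables $(X_e)_{e\in E}$ with known distributions. A set of edges is independent iff it forms a forest. Edges arrive in a known fixed order; when edge $e$ arrives its realized value $X_e$ is observed and the algorithm must immediately and irrevocably accept or reject it, keeping the accepted set a forest. $\mathbb{E}[\mathrm{ALG}]$ is the expected total value of accepted edges (over values and all randomness of the algorithm) and $\mathbb{E}[\mathrm{OPT}]$ is the expected value of the maximum-value forest in hindsight. Non-adaptive algorithm with thresholds $(T_e)_{e\in E}$, $T_e\in[0,+\infty]$: the thresholds are fixed before any value is realized; when edge $e$ arrives, it is accepted if and only if $X_e\ge T_e$ and adding $e$ keeps the accepted set a forest. Conventions: distributions are taken to be continuous, so that the required $T_v$ exists (vertices $v\in B$ with no edges to $A$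 need no threshold); for distributions with atoms, independent randomized tie-breaking at the threshold is used (an edge with $X_e=T_e$ is considered above its threshold with a prescribed probability) so that the stated probability is exactly $1/2$. -}

module Defs where

open import Algebra.Bundles using (CommutativeRing)
import Algebra.Definitions.RawMonoid as RawMonoidDefs
import Algebra.Properties.CommutativeMonoid.Sum as CommutativeMonoidSum
open import Axiom.ExcludedMiddle using (ExcludedMiddle)
open import Data.Bool.Base using (if_then_else_)
open import Data.Empty using (⊥)
open import Data.Fin.Base using (Fin; toℕ)
open import Data.Fin.Subset using (Subset; inside; outside; ⁅_⁆)
  renaming (_∈_ to _∈ˢ_; _∉_ to _∉ˢ_; _∪_ to _∪ˢ_; ⊥ to ∅ˢ)
open import Data.Fin.Subset.Properties using (_∈?_)
import Data.List.Extrema as Extrema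
open import Data.List.Base as List using (List; []; _∷_; _++_)
open import Data.List.Relation.Unary.All using (All)
open import Data.List.Relation.Unary.Unique.Propositional using (Unique)
open import Data.Nat.Base using (ℕ; zero; suc)
open import Data.Product.Base using (Σ; ∃; ∃-syntax; _×_; _,_; proj₁; proj₂)
open import Data.Sum.Base using (_⊎_)
import Data.Vec.Base as Vec
open import Data.Vec.Functional as VecF using (Vector)
open import Level using (0ℓ) renaming (suc to lsuc)
open import Relation.Binary.Bundles using (TotalOrder)
open import Relation.Binary.Core using (Rel)
open import Relation.Binary.PropositionalEquality using (_≡_; _≢_)
open import Relation.Binary.Structures using (IsTotalOrder)
import Relation.Binary.Construct.Add.Supremum.NonStrict as AddSupremum
import Relation.Binary.Construct.NonStrictToStrict as NonStrictToStrict
open import Relation.Nullary using (¬_; yes; no; does)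
open import Relation.Nullary.Construct.Add.Supremum using (_⁺; [_]; ⊤⁺)
open import Relation.Unary using (Pred; Satisfiable; U; ∁; ⋃; ⋂; _⊢_; _≐_; _⊥′_)

-- Vertices are Fin n and edges are Fin m; the order of Fin m is the
-- arrival order.  Parallel edges and loops are both allowed; a loop is a
-- cycle of length one, so it lies in no forest.
record Multigraph (n m : ℕ) : Set where
  field
    ends : Fin m → Fin n × Fin n

  Joins : Fin m → Fin n → Fin n → Set
  Joins e u v = ends e ≡ (u , v) ⊎ ends e ≡ (v , u)

  data Walk : Fin n → Fin n → Set where
    []   : ∀ {v} → Walk v v
    step : ∀ {u v w} (e : Fin m) → Joins e u v → Walk v w → Walk u w

  edges : ∀ {u v} → Walk u v → List (Fin m)
  edges []           = []
  edges (step e _ p) = e ∷ edges p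

  -- The vertices of a walk except its last one, so that the two ends of a
  -- closed walk are counted once.
  origins : ∀ {u v} → Walk u v → List (Fin n)
  origins []                 = []
  origins (step {u = u} _ _ p) = u ∷ origins p

  record CycleIn (F : Subset m) : Set where
    field
      {base}           : Fin n
      walk             : Walk base base
      nonEmpty         : edges walk ≢ []
      distinctEdges    : Unique (edges walk)
      distinctVertices : Unique (origins walk)
      contained        : All (_∈ˢ F) (edges walk)

  Forest : Subset m → Set
  Forest F = ¬ CycleIn F

subsets : ∀ m → List (Subset m)
subsets zero    = Vec.[] ∷ []
subsets (suc m) = List.map (outside Vec.∷_) (subsets m)
               ++ List.map (inside Vec.∷_) (subsets m)

-- The standard library has no real numbers.  They are given here by their
-- (classically categorical) axioms as a Dedekind-complete ordered field.
-- The value of 0# ⁻¹ is unspecified.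
record CompleteOrderedField : Set (lsuc (lsuc 0ℓ)) where
  infix 4 _≤_
  infix 8 _⁻¹
  field
    commutativeRing : CommutativeRing 0ℓ 0ℓ
  open CommutativeRing commutativeRing public
  field
    _≤_          : Rel Carrier 0ℓ
    isTotalOrder : IsTotalOrder _≈_ _≤_
    +-monoʳ-≤    : ∀ z {x y} → x ≤ y → z + x ≤ z + y
    *-nonNeg     : ∀ {x y} → 0# ≤ x → 0# ≤ y → 0# ≤ x * y
    0≉1          : ¬ (0# ≈ 1#)
    _⁻¹          : Carrier → Carrier
    *-inverseʳ   : ∀ x → ¬ (x ≈ 0#) → x * x ⁻¹ ≈ 1#

  UpperBound : ∀ {ℓ} → Pred Carrier ℓ → Pred Carrier ℓ
  UpperBound P b = ∀ x → P x → x ≤ b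

  IsSupremum : ∀ {ℓ} → Pred Carrier ℓ → Pred Carrier ℓ
  IsSupremum P s = UpperBound P s × (∀ b → UpperBound P b → s ≤ b)

  field
    complete : (P : Pred Carrier (lsuc 0ℓ)) →
               Satisfiable P → Satisfiable (UpperBound P) →
               Satisfiable (IsSupremum P)

  totalOrder : TotalOrder 0ℓ 0ℓ 0ℓ
  totalOrder = record { isTotalOrder = isTotalOrder }

  open NonStrictToStrict _≈_ _≤_ public using (_<_)
  open CommutativeMonoidSum +-commutativeMonoid public using (sum)
  open CommutativeMonoidSum *-commutativeMonoid public
    using () renaming (sum to product)

  fromℕ : ℕ → Carrier
  fromℕ k = RawMonoidDefs._×_ +-rawMonoid k 1#

  ½ : Carrier
  ½ = fromℕ 2 ⁻¹

  -- The Borel σ-algebra, generated by the closed rays [a , +∞).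
  data Borel : Pred Carrier 0ℓ → Set (lsuc 0ℓ) where
    ray        : ∀ a → Borel (a ≤_)
    complement : ∀ {A} → Borel A → Borel (∁ A)
    union      : ∀ {A : ℕ → Pred Carrier 0ℓ} →
                 (∀ i → Borel (A i)) → Borel (⋃ ℕ A)
    resp       : ∀ {A B} → A ≐ B → Borel A → Borel B

  -- Extended values: [ x ] is the real x and ⊤⁺ is +∞.
  Extended : Set
  Extended = Carrier ⁺

  open AddSupremum _≤_ public using (_≤⁺_)

  infixl 6 _+⁺_
  infixr 7 _·⁺_

  _+⁺_ : Extended → Extended → Extended
  [ x ] +⁺ [ y ] = [ x + y ]
  [ _ ] +⁺ ⊤⁺    = ⊤⁺
  ⊤⁺    +⁺ _     = ⊤⁺

  -- Only used for c > 0; in particular there is no convention for 0 · ∞.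
  _·⁺_ : Carrier → Extended → Extended
  c ·⁺ [ x ] = [ c * x ]
  c ·⁺ ⊤⁺    = ⊤⁺

-- Pr is a total function, but it is constrained only on events.
record ProbabilitySpace (ℝ : CompleteOrderedField) : Set (lsuc (lsuc 0ℓ)) where
  open CompleteOrderedField ℝ
  field
    Ω           : Set
    Event       : Pred Ω 0ℓ → Set (lsuc 0ℓ)
    Event-resp  : ∀ {A B} → A ≐ B → Event A → Event B
    Event-U     : Event U
    Event-∁     : ∀ {A} → Event A → Event (∁ A)
    Event-⋃     : ∀ {A : ℕ → Pred Ω 0ℓ} →
                  (∀ i → Event (A i)) → Event (⋃ ℕ A)

    Pr          : Pred Ω 0ℓ → Carrier
    Pr-cong     : ∀ {A B} → Event A → A ≐ B → Pr A ≈ Pr B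
    Pr-nonNeg   : ∀ {A} → Event A → 0# ≤ Pr A
    Pr-U        : Pr U ≈ 1#
    -- The sum of a series of nonnegative terms is the supremum of its
    -- partial sums.
    Pr-additive : ∀ {A : ℕ → Pred Ω 0ℓ} → (∀ i → Event (A i)) →
                  (∀ {i j} → i ≢ j → A i ⊥′ A j) →
                  IsSupremum
                    (λ s → ∃[ k ] s ≈ sum {k} (λ i → Pr (A (toℕ i))))
                    (Pr (⋃ ℕ A))

  RandomVariable : (Ω → Carrier) → Set (lsuc 0ℓ)
  RandomVariable Y = ∀ B → Borel B → Event (Y ⊢ B)

  -- Finite subfamilies are covered by taking the remaining Borel sets to be
  -- the whole line.
  Independent : ∀ {k} → Vector (Ω → Carrier) k → Set (lsuc 0ℓ)
  Independent {k} Y =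
    ∀ (B : Fin k → Pred Carrier 0ℓ) → (∀ i → Borel (B i)) →
    Pr (⋂ (Fin k) (λ i → Y i ⊢ B i)) ≈ product (λ i → Pr (Y i ⊢ B i))

-- The ambient mathematics is classical: excluded middle is used to define
-- indicator functions, suprema in [0 , +∞], and the greedy forest test.
module Expectation (em : ∀ {ℓ} → ExcludedMiddle ℓ)
                   (ℝ : CompleteOrderedField)
                   (𝒫 : ProbabilitySpace ℝ) where
  open CompleteOrderedField ℝ
  open ProbabilitySpace 𝒫

  indicator : Pred Ω 0ℓ → Ω → Carrier
  indicator A ω = if does (em {P = A ω}) then 1# else 0#

  -- A nonnegative simple function Σᵢ cᵢ 1_{Aᵢ}, as a list of its terms.
  record SimpleFunction : Set (lsuc 0ℓ) where
    field
      terms  : List (Carrier × Pred Ω 0ℓ)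
      nonNeg : All (λ t → 0# ≤ proj₁ t) terms
      events : All (λ t → Event (proj₂ t)) terms

    value : Ω → Carrier
    value ω = List.foldr (λ (c , A) s → c * indicator A ω + s) 0# terms

    integral : Carrier
    integral = List.foldr (λ (c , A) s → c * Pr A + s) 0# terms

  -- The supremum in [0 , +∞] of a nonempty set of nonnegative reals: by
  -- completeness, such a set has no real supremum only if it is unbounded.
  sup⁺ : Pred Carrier (lsuc 0ℓ) → Extended
  sup⁺ P with em {P = ∃ (IsSupremum P)}
  ... | yes (s , _) = [ s ]
  ... | no  _       = ⊤⁺

  -- The Lebesgue integral of a nonnegative random variable.
  𝔼 : (Ω → Carrier) → Extended
  𝔼 f = sup⁺ λ x → Σ SimpleFunction λ s →
    (∀ ω → SimpleFunction.value s ω ≤ f ω) × x ≈ SimpleFunction.integral s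

  -- Expectation over a random subset of Fin n that contains each element
  -- independently with probability 1/2.
  𝔼-subset : ∀ {n} → (Subset n → Extended) → Extended
  𝔼-subset {zero}  f = f Vec.[]
  𝔼-subset {suc n} f = ½ ·⁺ 𝔼-subset (λ S → f (inside Vec.∷ S))
                    +⁺ ½ ·⁺ 𝔼-subset (λ S → f (outside Vec.∷ S))

-- X e is the value of edge e.  Y e is an auxiliary seed used only to break
-- a tie X e = T e: with prescribed level q e, the tie counts as above the
-- threshold iff Y e ≤ q e, i.e. with probability Pr[Y e ≤ q e] (which is
-- q e itself for a seed uniform on [0 , 1]).  With a constant seed below
-- the levels this is the rule X e ≥ T e, as for continuous distributions.
record ProphetInstance (ℝ : CompleteOrderedField) (𝒫 : ProbabilitySpace ℝ)
                       (n m : ℕ) : Set (lsuc 0ℓ) where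
  open CompleteOrderedField ℝ
  open ProbabilitySpace 𝒫
  field
    graph       : Multigraph n m
    X           : Vector (Ω → Carrier) m
    Y           : Vector (Ω → Carrier) m
    X-rv        : ∀ e → RandomVariable (X e)
    Y-rv        : ∀ e → RandomVariable (Y e)
    X-nonNeg    : ∀ e ω → 0# ≤ X e ω
    independent : Independent (X VecF.++ Y)
  open Multigraph graph public

module Prophet (em : ∀ {ℓ} → ExcludedMiddle ℓ)
               (ℝ : CompleteOrderedField) (𝒫 : ProbabilitySpace ℝ)
               {n m : ℕ} (I : ProphetInstance ℝ 𝒫 n m) where
  open CompleteOrderedField ℝ
  open ProbabilitySpace 𝒫
  open Expectation em ℝ 𝒫
  open ProphetInstance I

  weight : Subset m → Ω → Carrier
  weight F ω = sum λ e → if does (e ∈? F) then X e ω else 0#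

  -- The empty forest has weight 0#, so 0# does not affect the maximum.
  opt : Ω → Carrier
  opt ω = Extrema.max totalOrder 0#
    (List.map (λ F → weight F ω) (List.filter (λ F → em {P = Forest F}) (subsets m)))

  𝔼[OPT] : Extended
  𝔼[OPT] = 𝔼 opt

  AboveThreshold : Extended → Carrier → Fin m → Ω → Set
  AboveThreshold ⊤⁺    q e ω = ⊥
  AboveThreshold [ t ] q e ω = t < X e ω ⊎ (X e ω ≈ t × Y e ω ≤ q)

  -- The non-adaptive algorithm with thresholds T and tie-breaking levels q.
  module NonAdaptive (T : Fin m → Extended) (q : Fin m → Carrier) where

    arrive : Ω → Subset m → Fin m → Subset m
    arrive ω F e =
      if does (em {P = AboveThreshold (T e) (q e) e ω × Forest (F ∪ˢ ⁅ e ⁆)})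
      then F ∪ˢ ⁅ e ⁆ else F

    accepted : Ω → Subset m
    accepted ω = List.foldl (arrive ω) ∅ˢ (List.allFin m)

    alg : Ω → Carrier
    alg ω = weight (accepted ω) ω

  -- In what follows the set A ⊆ V is fixed and B is its complement.

  -- Some edge from v to A is above the threshold t, i.e. the maximum value
  -- of such an edge is at least t, subject to tie-breaking.
  SomeAbove : Subset n → Carrier → (Fin m → Carrier) → Fin n → Pred Ω 0ℓ
  SomeAbove A t q v ω =
    ∃[ e ] ∃[ u ] (Joins e v u × u ∈ˢ A × AboveThreshold [ t ] (q e) e ω)

  MedianThresholds : Subset n → (Fin n → Carrier) → (Fin m → Carrier) → Set
  MedianThresholds A T q =
    ∀ v → v ∉ˢ A → (∃[ e ] ∃[ u ] (Joins e v u × u ∈ˢ A)) →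
    Pr (SomeAbove A (T v) q v) ≈ ½

  edgeThreshold : Subset n → (Fin n → Carrier) → Fin m → Extended
  edgeThreshold A T e with ends e
  ... | u , v with u ∈? A | v ∈? A
  ...   | no  _ | yes _ = [ T u ]
  ...   | yes _ | no  _ = [ T v ]
  ...   | yes _ | yes _ = ⊤⁺
  ...   | no  _ | no  _ = ⊤⁺

  -- The vertex thresholds T and tie-breaking levels q may depend on A.
  -- The values, and the seeds, are independent of A.
  𝔼[ALG] : (Subset n → Fin n → Carrier) → (Subset n → Fin m → Carrier) →
           Extended
  𝔼[ALG] T q = 𝔼-subset λ A →
    𝔼 (NonAdaptive.alg (edgeThreshold A (T A)) (q A))

{-# OPTIONS --safe #-}

-- Orient every edge of a forest so that each vertex is the child of at most
-- one edge.  An edge (child v, other end u) is cut with v ∈ B and u ∈ A with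
-- probability 1/4, so OPT ≤ 4 E_A[Σ_{v ∈ B} max over the edges at v into A].
-- For fixed A, the first edge at v ∈ B to exceed T_v finds v isolated and is
-- therefore accepted; since no edge at v exceeds T_v with probability 1/2,
-- the single-item prophet inequality with the median threshold loses another
-- factor 2:  max X_e ≤ T + Σ (X_e - T)⁺, whereas the first edge above T earns
-- T/2 + Σ E[(X_e - T)⁺] Pr[nothing above T before e] in expectation.
--
-- Integrals are only ever taken of simple functions: a simple s ≤ OPT is
-- bounded by some K, and (X_e - T)⁺ is replaced by its rounding down to
-- multiples of δ, at most N δ ≥ K; the error is at most 4 n δ.
module Submission where

open import Axiom.ExcludedMiddle using (ExcludedMiddle)
import Algebra.Construct.NaturalChoice.Min as Min
import Algebra.Properties.Monoid.Mult as MonoidMult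
import Algebra.Properties.Ring as RingProperties
import Algebra.Properties.Semiring.Sum as SemiringSum
import Algebra.Solver.Ring.NaturalCoefficients.Default as NaturalCoefficients
open import Data.Bool.Base using (if_then_else_)
open import Data.Empty using (⊥; ⊥-elim)
open import Data.Fin.Base as Fin using (Fin; zero; suc; toℕ; _↑ˡ_; _↑ʳ_; splitAt)
open import Data.Fin.Induction using (<-wellFounded)
open import Data.Fin.Properties
  using (suc-injective; _≟_; splitAt-↑ˡ; splitAt-↑ʳ; ↑ˡ-injective; <-irrefl)
open import Data.Fin.Subset using (Subset; inside; outside; ⁅_⁆)
  renaming (_∈_ to _∈ˢ_; _∉_ to _∉ˢ_; _∪_ to _∪ˢ_; ⊥ to ∅ˢ)
open import Data.Fin.Subset.Properties
  using (_∈?_; drop-there; x∈p∪q⁺; x∈p∪q⁻; x∈⁅x⁆; x∈⁅y⁆⇒x≡y; ∉⊥)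
open import Data.List.Base as List using (List; []; _∷_; _++_; allFin)
import Data.List.Extrema as Extrema
open import Data.List.Membership.Propositional using (_∈_; _∉_)
open import Data.List.Membership.Propositional.Properties using (∈-filter⁺; ∈-filter⁻; ∈-allFin)
open import Data.List.Relation.Unary.All as All using (All; []; _∷_)
import Data.List.Relation.Unary.All.Properties as All
open import Data.List.Relation.Unary.AllPairs using (AllPairs; []; _∷_)
import Data.List.Relation.Unary.AllPairs.Properties as AllPairs
open import Data.List.Relation.Unary.Any using (here; there)
open import Data.List.Relation.Unary.Unique.Propositional using (Unique)
import Data.List.Relation.Unary.Unique.Propositional.Properties as Unique
open import Data.Nat.Base using (ℕ; zero; suc)
open import Data.Product.Base using (Σ; ∃; ∃-syntax; _×_; _,_; proj₁; proj₂; swap)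
open import Data.Product.Properties using (,-injective)
open import Data.Sum.Base as Sum using (_⊎_; inj₁; inj₂; [_,_]′)
open import Data.Unit.Base using (tt)
import Data.Vec.Base as Vec
open import Data.Vec.Base using (here; there)
open import Data.Vec.Functional as VecF using (Vector)
open import Data.Vec.Functional.Properties using (lookup-++ˡ; lookup-++ʳ)
open import Defs
open import Function.Base using (_∘_; id; case_of_)
open import Induction.WellFounded using (Acc; acc)
open import Level using (Lift; lift; 0ℓ) renaming (suc to lsuc)
open import Relation.Binary.Bundles using (TotalOrder)
import Relation.Binary.Construct.Add.Supremum.NonStrict as AddSupremum
open import Relation.Binary.PropositionalEquality as ≡ using (_≡_; _≢_)
import Relation.Binary.Reasoning.PartialOrder as PartialOrderReasoning
open import Relation.Binary.Structures using (IsTotalOrder)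
open import Relation.Nullary using (¬_; Dec; yes; no; does; contradiction)
open import Relation.Nullary.Construct.Add.Supremum using ([_]; ⊤⁺)
open import Relation.Nullary.Decidable using (decidable-stable)
open import Relation.Unary
  using (Pred; U; ∅; ∁; ⋃; ⋂; _∩_; _∪_; _⊆_; _⊢_; _≐_; _⊥′_)

-- `𝔼` is a supremum over simple minorants, so neither its additivity nor the measurability of OPT
-- and ALG is at hand. The comparison therefore runs through explicit step functions: a simple
-- `s ≤ opt` lies below `bound`, each `lower` lies below `alg`, and only the integrals of `bound`
-- and `lower` are related. A simple minorant is bounded even when the expectation of OPT is
-- infinite, so finitely many steps suffice.
--
-- Independence is given as a product formula for boxes, but "no earlier edge beats the threshold"
-- is not a box once ties are broken by seeds: an edge loses by a smaller value, or by a tie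
-- together with a bad seed. It is a finite disjoint union of boxes, and `Free` collects such unions
-- that leave one chosen coordinate unconstrained.
--
-- The random set `A` is not part of `Ω`. It is a finite average, which commutes with integrals by
-- finite linearity.

-- Ordered field arithmetic and finite sums

module OrderedField (em : ∀ {ℓ} → ExcludedMiddle ℓ) (ℝ : CompleteOrderedField) where
  open CompleteOrderedField ℝ hiding (zero)
  open IsTotalOrder isTotalOrder public
    using (antisym; total; ≤-respˡ-≈; ≤-respʳ-≈)
    renaming (refl to ≤-refl; trans to ≤-trans; reflexive to ≤-reflexive)
  open RingProperties ring public using (-1*x≈-x; -‿involutive)
  open NaturalCoefficients commutativeSemiring public
    using (solve; Polynomial; con; _:+_; _:*_; _:=_)
  open Min totalOrder public using (_⊓_; x⊓y≤x; x⊓y≤y)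
  open MonoidMult +-monoid public using () renaming (_×_ to _·_)
  open SemiringSum semiring public
    using (∑-distrib-+; ∑-comm; *-distribˡ-sum)
  module ≤-Reasoning = PartialOrderReasoning (TotalOrder.poset totalOrder)
  open ≤-Reasoning

  -- Evaluates to fromℕ k on the nose, whereas con k evaluates to 1# + … + 1#
  -- without a trailing 0#.
  lit : ∀ {k} → ℕ → Polynomial k
  lit zero    = con 0
  lit (suc n) = con 1 :+ lit n

  +-monoˡ-≤ : ∀ z {x y} → x ≤ y → x + z ≤ y + z
  +-monoˡ-≤ z {x} {y} x≤y = begin
    x + z ≈⟨ +-comm x z ⟩
    z + x ≤⟨ +-monoʳ-≤ z x≤y ⟩
    z + y ≈⟨ +-comm z y ⟩
    y + z ∎

  +-mono-≤ : ∀ {x y u v} → x ≤ y → u ≤ v → x + u ≤ y + v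
  +-mono-≤ {y = y} {u = u} x≤y u≤v = ≤-trans (+-monoˡ-≤ u x≤y) (+-monoʳ-≤ y u≤v)

  -x+[x+y]≈y : ∀ x y → - x + (x + y) ≈ y
  -x+[x+y]≈y x y = begin-equality
    - x + (x + y) ≈⟨ +-assoc (- x) x y ⟨
    - x + x + y   ≈⟨ +-congʳ (-‿inverseˡ x) ⟩
    0# + y        ≈⟨ +-identityˡ y ⟩
    y             ∎

  x+[-x+y]≈y : ∀ x y → x + (- x + y) ≈ y
  x+[-x+y]≈y x y = begin-equality
    x + (- x + y) ≈⟨ +-assoc x (- x) y ⟨
    x + - x + y   ≈⟨ +-congʳ (-‿inverseʳ x) ⟩
    0# + y        ≈⟨ +-identityˡ y ⟩
    y             ∎

  +-cancelˡ-≤ : ∀ z {x y} → z + x ≤ z + y → x ≤ y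
  +-cancelˡ-≤ z {x} {y} le = begin
    x             ≈⟨ -x+[x+y]≈y z x ⟨
    - z + (z + x) ≤⟨ +-monoʳ-≤ (- z) le ⟩
    - z + (z + y) ≈⟨ -x+[x+y]≈y z y ⟩
    y             ∎

  +-nonNeg : ∀ {x y} → 0# ≤ x → 0# ≤ y → 0# ≤ x + y
  +-nonNeg 0≤x 0≤y = ≤-respˡ-≈ (+-identityˡ 0#) (+-mono-≤ 0≤x 0≤y)

  x≤x+y : ∀ {x y} → 0# ≤ y → x ≤ x + y
  x≤x+y {x} 0≤y = ≤-respˡ-≈ (+-identityʳ x) (+-monoʳ-≤ x 0≤y)

  x≤y+x : ∀ {x y} → 0# ≤ y → x ≤ y + x
  x≤y+x {x} 0≤y = ≤-respˡ-≈ (+-identityˡ x) (+-monoˡ-≤ x 0≤y)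

  *-monoˡ-≤ : ∀ {c x y} → 0# ≤ c → x ≤ y → c * x ≤ c * y
  *-monoˡ-≤ {c} {x} {y} 0≤c x≤y = begin
    c * x                 ≤⟨ x≤x+y (*-nonNeg 0≤c 0≤d) ⟩
    c * x + c * (- x + y) ≈⟨ distribˡ c x (- x + y) ⟨
    c * (x + (- x + y))   ≈⟨ *-congˡ (x+[-x+y]≈y x y) ⟩
    c * y                 ∎
    where
    0≤d : 0# ≤ - x + y
    0≤d = ≤-respˡ-≈ (-‿inverseˡ x) (+-monoʳ-≤ (- x) x≤y)

  *-monoʳ-≤ : ∀ {c x y} → 0# ≤ c → x ≤ y → x * c ≤ y * c
  *-monoʳ-≤ {c} {x} {y} 0≤c x≤y = begin
    x * c ≈⟨ *-comm x c ⟩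
    c * x ≤⟨ *-monoˡ-≤ 0≤c x≤y ⟩
    c * y ≈⟨ *-comm c y ⟩
    y * c ∎

  ≰⇒≥ : ∀ {x y} → ¬ (x ≤ y) → y ≤ x
  ≰⇒≥ {x} {y} x≰y with total x y
  ... | inj₁ x≤y = ⊥-elim (x≰y x≤y)
  ... | inj₂ y≤x = y≤x

  ≮⇒≥ : ∀ {x y} → ¬ (x < y) → y ≤ x
  ≮⇒≥ {x} {y} x≮y with total x y | em {P = x ≈ y}
  ... | inj₂ y≤x | _       = y≤x
  ... | inj₁ _   | yes x≈y = ≤-reflexive (sym x≈y)
  ... | inj₁ x≤y | no  x≉y = ⊥-elim (x≮y (x≤y , x≉y))

  <-≤-trans : ∀ {x y z} → x < y → y ≤ z → x < z
  <-≤-trans (x≤y , x≉y) y≤z =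
    ≤-trans x≤y y≤z , λ x≈z → x≉y (antisym x≤y (≤-respʳ-≈ (sym x≈z) y≤z))

  0≤1 : 0# ≤ 1#
  0≤1 with total 0# 1#
  ... | inj₁ 0≤1 = 0≤1
  ... | inj₂ 1≤0 = begin
    0#          ≤⟨ *-nonNeg 0≤-1 0≤-1 ⟩
    - 1# * - 1# ≈⟨ -1*x≈-x (- 1#) ⟩
    - - 1#      ≈⟨ -‿involutive 1# ⟩
    1#          ∎
    where
    0≤-1 : 0# ≤ - 1#
    0≤-1 = begin
      0#        ≈⟨ -‿inverseˡ 1# ⟨
      - 1# + 1# ≤⟨ +-monoʳ-≤ (- 1#) 1≤0 ⟩
      - 1# + 0# ≈⟨ +-identityʳ (- 1#) ⟩
      - 1#      ∎

  fromℕ-nonNeg : ∀ k → 0# ≤ fromℕ k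
  fromℕ-nonNeg zero    = ≤-refl
  fromℕ-nonNeg (suc k) = +-nonNeg 0≤1 (fromℕ-nonNeg k)

  ·≈fromℕ* : ∀ k x → k · x ≈ fromℕ k * x
  ·≈fromℕ* zero    x = sym (zeroˡ x)
  ·≈fromℕ* (suc k) x = sym (trans (distribʳ x 1# (fromℕ k)) (+-cong (*-identityˡ x) (sym (·≈fromℕ* k x))))

  1+x≉0 : ∀ {x} → 0# ≤ x → ¬ (1# + x ≈ 0#)
  1+x≉0 0≤x 1+x≈0 = 0≉1 (antisym 0≤1 (≤-respʳ-≈ 1+x≈0 (x≤x+y 0≤x)))

  ⁻¹-nonNeg : ∀ {x} → 0# ≤ x → ¬ (x ≈ 0#) → 0# ≤ x ⁻¹
  ⁻¹-nonNeg {x} 0≤x x≉0 with total 0# (x ⁻¹)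
  ... | inj₁ 0≤x⁻¹ = 0≤x⁻¹
  ... | inj₂ x⁻¹≤0 = ⊥-elim (0≉1 (antisym 0≤1 (begin
    1#       ≈⟨ *-inverseʳ x x≉0 ⟨
    x * x ⁻¹ ≤⟨ *-monoˡ-≤ 0≤x x⁻¹≤0 ⟩
    x * 0#   ≈⟨ zeroʳ x ⟩
    0#       ∎)))

  0≤½ : 0# ≤ ½
  0≤½ = ⁻¹-nonNeg (fromℕ-nonNeg 2) (1+x≉0 (fromℕ-nonNeg 1))

  2*½≈1 : fromℕ 2 * ½ ≈ 1#
  2*½≈1 = *-inverseʳ (fromℕ 2) (1+x≉0 (fromℕ-nonNeg 1))

  ½x+½x≈x : ∀ x → ½ * x + ½ * x ≈ x
  ½x+½x≈x x = begin-equality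
    ½ * x + ½ * x     ≈⟨ solve 2 (λ h x → h :* x :+ h :* x := lit 2 :* h :* x) refl ½ x ⟩
    fromℕ 2 * ½ * x   ≈⟨ *-congʳ 2*½≈1 ⟩
    1# * x            ≈⟨ *-identityˡ x ⟩
    x                 ∎

  4*[½*[½*x]]≈x : ∀ x → fromℕ 4 * (½ * (½ * x)) ≈ x
  4*[½*[½*x]]≈x x = begin-equality
    fromℕ 4 * (½ * (½ * x)) ≈⟨ solve 2 (λ h x → lit 4 :* (h :* (h :* x)) := lit 2 :* h :* (lit 2 :* h :* x)) refl ½ x ⟩
    fromℕ 2 * ½ * (fromℕ 2 * ½ * x) ≈⟨ *-cong 2*½≈1 (*-congʳ 2*½≈1) ⟩
    1# * (1# * x) ≈⟨ trans (*-identityˡ _) (*-identityˡ x) ⟩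
    x ∎

  x+x≤x⇒x≤0 : ∀ {x} → x + x ≤ x → x ≤ 0#
  x+x≤x⇒x≤0 {x} le = +-cancelˡ-≤ x (≤-respʳ-≈ (sym (+-identityʳ x)) le)

  -- If every multiple of `δ` stayed below `K`, the multiples would have a supremum `s`. The
  -- successor of each multiple is again at most `s`, so `s - δ` would also be an upper bound,
  -- contradicting leastness.
  archimedean : ∀ {δ} → 0# < δ → ∀ K → ∃ λ N → K ≤ N · δ
  archimedean {δ} (0≤δ , 0≉δ) K with em {P = ∃ λ N → K ≤ N · δ}
  ... | yes found = found
  ... | no ¬found = ⊥-elim (0≉δ (antisym 0≤δ (+-cancelˡ-≤ (- δ + s) (begin
    - δ + s + δ  ≈⟨ trans (+-assoc (- δ) s δ) (+-congˡ (+-comm s δ)) ⟩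
    - δ + (δ + s) ≈⟨ -x+[x+y]≈y δ s ⟩
    s             ≤⟨ least (- δ + s) below ⟩
    - δ + s       ≈⟨ +-identityʳ _ ⟨
    - δ + s + 0# ∎))))
    where
    Multiple : Carrier → Set₁
    Multiple x = Lift (lsuc 0ℓ) (∃ λ N → x ≈ N · δ)
    supremum : ∃ (IsSupremum Multiple)
    supremum = complete Multiple (0# , lift (0 , refl)) (K , λ where
      x (lift (N , x≈Nδ)) → ≤-respˡ-≈ (sym x≈Nδ) (≰⇒≥ λ K≤Nδ → ¬found (N , K≤Nδ)))
    s : Carrier
    s = proj₁ supremum
    upper : UpperBound Multiple s
    upper = proj₁ (proj₂ supremum)
    least : ∀ b → UpperBound Multiple b → s ≤ b
    least = proj₂ (proj₂ supremum)
    below : UpperBound Multiple (- δ + s)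
    below x (lift (N , x≈Nδ)) = +-cancelˡ-≤ δ (begin
      δ + x         ≈⟨ +-congˡ x≈Nδ ⟩
      suc N · δ     ≤⟨ upper _ (lift (suc N , refl)) ⟩
      s             ≈⟨ x+[-x+y]≈y δ s ⟨
      δ + (- δ + s) ∎)

  -- A positive gap `d = x - y` is refuted by the `δ` for which `(1 + c) δ` is half of `d`, since it
  -- yields `d ≤ d / 2`. Adding 1 to `c` makes the division possible when `c` is zero.
  ≤-byEpsilon : ∀ {c x y} → 0# ≤ c → (∀ δ → 0# < δ → x ≤ y + c * δ) → x ≤ y
  ≤-byEpsilon {c} {x} {y} 0≤c approx with em {P = x ≤ y}
  ... | yes x≤y = x≤y
  ... | no  x≰y = ⊥-elim (d≉0 (antisym d≤0 0≤d))
    where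
    d c′ δ : Carrier
    d = - y + x
    c′ = 1# + c
    δ = c′ ⁻¹ * (½ * d)
    0≤c′ : 0# ≤ c′
    0≤c′ = +-nonNeg 0≤1 0≤c
    0≤d : 0# ≤ d
    0≤d = ≤-respˡ-≈ (-‿inverseˡ y) (+-monoʳ-≤ (- y) (≰⇒≥ x≰y))
    d≉0 : ¬ (d ≈ 0#)
    d≉0 d≈0 = x≰y (≤-reflexive (begin-equality
      x             ≈⟨ x+[-x+y]≈y y x ⟨
      y + (- y + x) ≈⟨ +-congˡ d≈0 ⟩
      y + 0#        ≈⟨ +-identityʳ y ⟩
      y             ∎))
    c′δ≈½d : c′ * δ ≈ ½ * d
    c′δ≈½d = begin-equality
      c′ * (c′ ⁻¹ * (½ * d)) ≈⟨ *-assoc c′ (c′ ⁻¹) (½ * d) ⟨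
      c′ * c′ ⁻¹ * (½ * d)   ≈⟨ *-congʳ (*-inverseʳ c′ (1+x≉0 0≤c)) ⟩
      1# * (½ * d)           ≈⟨ *-identityˡ _ ⟩
      ½ * d                  ∎
    0≤δ : 0# ≤ δ
    0≤δ = *-nonNeg (⁻¹-nonNeg 0≤c′ (1+x≉0 0≤c)) (*-nonNeg 0≤½ 0≤d)
    0≉δ : ¬ (0# ≈ δ)
    0≉δ 0≈δ = d≉0 (begin-equality
      d               ≈⟨ ½x+½x≈x d ⟨
      ½ * d + ½ * d   ≈⟨ +-cong c′δ≈½d c′δ≈½d ⟨
      c′ * δ + c′ * δ ≈⟨ +-cong (*-congˡ 0≈δ) (*-congˡ 0≈δ) ⟨
      c′ * 0# + c′ * 0# ≈⟨ +-cong (zeroʳ c′) (zeroʳ c′) ⟩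
      0# + 0#         ≈⟨ +-identityˡ 0# ⟩
      0#              ∎)
    d≤½d : d ≤ ½ * d
    d≤½d = +-cancelˡ-≤ y (begin
      y + d      ≈⟨ x+[-x+y]≈y y x ⟩
      x          ≤⟨ approx δ (0≤δ , 0≉δ) ⟩
      y + c * δ  ≤⟨ +-monoʳ-≤ y (*-monoʳ-≤ 0≤δ (x≤y+x 0≤1)) ⟩
      y + c′ * δ ≈⟨ +-congˡ c′δ≈½d ⟩
      y + ½ * d  ∎)
    d≤0 : d ≤ 0#
    d≤0 = x+x≤x⇒x≤0 (begin
      d + d         ≤⟨ +-mono-≤ d≤½d d≤½d ⟩
      ½ * d + ½ * d ≈⟨ ½x+½x≈x d ⟩
      d             ∎)

  when : Set → Carrier → Carrier
  when P x = if does (em {P = P}) then x else 0#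

  when-true : ∀ {P} → P → ∀ x → when P x ≡ x
  when-true {P} p x with em {P = P}
  ... | yes _ = ≡.refl
  ... | no ¬p = ⊥-elim (¬p p)

  when-false : ∀ {P} → ¬ P → ∀ x → when P x ≡ 0#
  when-false {P} ¬p x with em {P = P}
  ... | yes p = ⊥-elim (¬p p)
  ... | no _  = ≡.refl

  when-cong : ∀ {P Q} → (P → Q) → (Q → P) → ∀ x → when P x ≡ when Q x
  when-cong {P} P⇒Q Q⇒P x with em {P = P}
  ... | yes p = ≡.sym (when-true (P⇒Q p) x)
  ... | no ¬p = ≡.sym (when-false (¬p ∘ Q⇒P) x)

  when-elim : ∀ {P x} (Q : Carrier → Set) → (P → Q x) → (¬ P → Q 0#) → Q (when P x)
  when-elim {P} Q t f with em {P = P}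
  ... | yes p = t p
  ... | no ¬p = f ¬p

  when-nonNeg : ∀ {P x} → (P → 0# ≤ x) → 0# ≤ when P x
  when-nonNeg 0≤x = when-elim (0# ≤_) 0≤x (λ _ → ≤-refl)

  -- At `P = A ω` this unfolds to `indicator A ω`, so values of simple functions can be stated with
  -- it directly.
  𝟙 : Set → Carrier
  𝟙 P = when P 1#

  𝟙-∩ : ∀ {P Q} → 𝟙 P * 𝟙 Q ≈ 𝟙 (P × Q)
  𝟙-∩ {P} {Q} with em {P = P} | em {P = Q}
  ... | yes p | yes q = trans (*-identityʳ 1#) (sym (reflexive (when-true (p , q) 1#)))
  ... | yes p | no ¬q = trans (*-identityˡ 0#) (sym (reflexive (when-false (¬q ∘ proj₂) 1#)))
  ... | no ¬p | _     = trans (zeroˡ _) (sym (reflexive (when-false (¬p ∘ proj₁) 1#)))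

  sum-mono : ∀ {k} {f g : Fin k → Carrier} → (∀ i → f i ≤ g i) → sum f ≤ sum g
  sum-mono {zero}  f≤g = ≤-refl
  sum-mono {suc k} f≤g = +-mono-≤ (f≤g zero) (sum-mono (f≤g ∘ suc))

  sum-nonNeg : ∀ {k} {f : Fin k → Carrier} → (∀ i → 0# ≤ f i) → 0# ≤ sum f
  sum-nonNeg {zero}  0≤f = ≤-refl
  sum-nonNeg {suc k} 0≤f = +-nonNeg (0≤f zero) (sum-nonNeg (0≤f ∘ suc))

  sum-nonPos : ∀ {k} {f : Fin k → Carrier} → (∀ i → f i ≤ 0#) → sum f ≤ 0#
  sum-nonPos {zero}  f≤0 = ≤-refl
  sum-nonPos {suc k} f≤0 = ≤-respʳ-≈ (+-identityˡ 0#) (+-mono-≤ (f≤0 zero) (sum-nonPos (f≤0 ∘ suc)))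

  term≤sum : ∀ {k} {f : Fin k → Carrier} → (∀ i → 0# ≤ f i) → ∀ i → f i ≤ sum f
  term≤sum 0≤f zero    = x≤x+y (sum-nonNeg (0≤f ∘ suc))
  term≤sum 0≤f (suc i) = ≤-trans (term≤sum (0≤f ∘ suc) i) (x≤y+x (0≤f zero))

  sum≤bound : ∀ {k} {f : Fin k → Carrier} {b} → (∀ i → f i ≤ b) → sum f ≤ k · b
  sum≤bound {zero}  f≤b = ≤-refl
  sum≤bound {suc k} f≤b = +-mono-≤ (f≤b zero) (sum≤bound (f≤b ∘ suc))

  -- At most one summand survives. This serves both halves of the charging: an edge is cut at one
  -- vertex only, and a vertex is the child end of one edge only.
  sum-when-unique : ∀ {k} {P : Fin k → Set} {f : Fin k → Carrier} {b} →
    (∀ {i j} → P i → P j → i ≡ j) → (∀ i → P i → f i ≤ b) → 0# ≤ b →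
    sum (λ i → when (P i) (f i)) ≤ b
  sum-when-unique {zero} unique f≤b 0≤b = 0≤b
  sum-when-unique {suc k} {P} {f} {b} unique f≤b 0≤b with em {P = P zero}
  ... | yes p = begin
    f zero + sum (λ i → when (P (suc i)) (f (suc i))) ≤⟨ +-mono-≤ (f≤b zero p) (sum-nonPos (tail≤0 p)) ⟩
    b + 0# ≈⟨ +-identityʳ b ⟩
    b ∎
    where
    tail≤0 : P zero → ∀ i → when (P (suc i)) (f (suc i)) ≤ 0#
    tail≤0 p i = when-elim (_≤ 0#) (λ q → case unique p q of λ ()) (λ _ → ≤-refl)
  ... | no _ = ≤-respˡ-≈ (sym (+-identityˡ _))
    (sum-when-unique (λ p q → suc-injective (unique p q)) (f≤b ∘ suc) 0≤b)

  ⊓-nonNeg : ∀ {x y} → 0# ≤ x → 0# ≤ y → 0# ≤ x ⊓ y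
  ⊓-nonNeg {x} {y} 0≤x 0≤y with total x y
  ... | inj₁ _ = 0≤x
  ... | inj₂ _ = 0≤y

  -- If no term exceeds `K`, truncation changes nothing; otherwise one truncated term is already
  -- `K`, hence at least `s`. Bounded terms are what a staircase with finitely many steps can
  -- follow.
  truncated-sum : ∀ {k} {f : Fin k → Carrier} {s K} → (∀ i → 0# ≤ f i) →
    0# ≤ K → s ≤ K → s ≤ sum f → s ≤ sum (λ i → f i ⊓ K)
  truncated-sum {zero} 0≤f 0≤K s≤K s≤Σ = s≤Σ
  truncated-sum {suc k} {f} {s} {K} 0≤f 0≤K s≤K s≤Σ with total (f zero) K
  ... | inj₁ f₀≤K = begin
    s                     ≈⟨ x+[-x+y]≈y (f zero) s ⟨
    f zero + (- f zero + s) ≤⟨ +-monoʳ-≤ (f zero) (truncated-sum (0≤f ∘ suc) 0≤K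
        (≤-trans (+-cancelˡ-≤ (f zero) (≤-respˡ-≈ (sym (x+[-x+y]≈y (f zero) s)) (x≤y+x (0≤f zero)))) s≤K)
        (+-cancelˡ-≤ (f zero) (≤-respˡ-≈ (sym (x+[-x+y]≈y (f zero) s)) s≤Σ))) ⟩
    f zero + sum (λ i → f (suc i) ⊓ K) ∎
  ... | inj₂ K≤f₀ = ≤-trans s≤K (x≤x+y (sum-nonNeg λ i → ⊓-nonNeg (0≤f (suc i)) 0≤K))

  -- Averages over a uniformly random vertex set

  -- The recursion copies that of `𝔼-subset`, with real instead of extended values, so that the two
  -- can be compared by induction.
  average : ∀ n → (Subset n → Carrier) → Carrier
  average zero  f = f Vec.[]
  average (suc n) f = ½ * average n (f ∘ (inside Vec.∷_)) + ½ * average n (f ∘ (outside Vec.∷_))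

  average-mono : ∀ n {f g : Subset n → Carrier} → (∀ A → f A ≤ g A) → average n f ≤ average n g
  average-mono zero  f≤g = f≤g Vec.[]
  average-mono (suc n) f≤g = +-mono-≤
    (*-monoˡ-≤ 0≤½ (average-mono n λ A → f≤g (inside Vec.∷ A)))
    (*-monoˡ-≤ 0≤½ (average-mono n λ A → f≤g (outside Vec.∷ A)))

  average-cong : ∀ n {f g : Subset n → Carrier} → (∀ A → f A ≈ g A) → average n f ≈ average n g
  average-cong n f≈g = antisym (average-mono n (≤-reflexive ∘ f≈g)) (average-mono n (≤-reflexive ∘ sym ∘ f≈g))

  average-const : ∀ n c → average n (λ _ → c) ≈ c
  average-const zero    c = refl
  average-const (suc n) c =
    trans (+-cong (*-congˡ (average-const n c)) (*-congˡ (average-const n c))) (½x+½x≈x c)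

  average-+ : ∀ n (f g : Subset n → Carrier) →
    average n (λ A → f A + g A) ≈ average n f + average n g
  average-+ zero  f g = refl
  average-+ (suc n) f g = begin-equality
    ½ * average n (λ A → f (inside Vec.∷ A) + g (inside Vec.∷ A)) +
    ½ * average n (λ A → f (outside Vec.∷ A) + g (outside Vec.∷ A))
      ≈⟨ +-cong (*-congˡ (average-+ n _ _)) (*-congˡ (average-+ n _ _)) ⟩
    ½ * (average n _ + average n _) + ½ * (average n _ + average n _)
      ≈⟨ solve 5 (λ h a b c d → h :* (a :+ b) :+ h :* (c :+ d) := (h :* a :+ h :* c) :+ (h :* b :+ h :* d)) refl ½ _ _ _ _ ⟩
    _ ∎

  average-* : ∀ n c (f : Subset n → Carrier) → average n (λ A → c * f A) ≈ c * average n f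
  average-* zero  c f = refl
  average-* (suc n) c f = begin-equality
    ½ * average n (λ A → c * f (inside Vec.∷ A)) + ½ * average n (λ A → c * f (outside Vec.∷ A))
      ≈⟨ +-cong (*-congˡ (average-* n c _)) (*-congˡ (average-* n c _)) ⟩
    ½ * (c * average n _) + ½ * (c * average n _)
      ≈⟨ solve 4 (λ h c a b → h :* (c :* a) :+ h :* (c :* b) := c :* (h :* a :+ h :* b)) refl ½ c _ _ ⟩
    _ ∎

  average-sum : ∀ n {k} (f : Subset n → Fin k → Carrier) →
    average n (λ A → sum (f A)) ≈ sum (λ i → average n λ A → f A i)
  average-sum n {zero}  f = average-const n 0#
  average-sum n {suc k} f = trans (average-+ n _ _) (+-congˡ (average-sum n λ A i → f A (suc i)))

  average-when-suc : ∀ n (P : Subset (suc n) → Set) {x} {g h : Subset n → Carrier} →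
    (∀ A → when (P (inside Vec.∷ A)) x ≡ g A) → (∀ A → when (P (outside Vec.∷ A)) x ≡ h A) →
    average (suc n) (λ A → when (P A) x) ≈ ½ * average n g + ½ * average n h
  average-when-suc n P f≡g f≡h = +-cong
    (*-congˡ (average-cong n (reflexive ∘ f≡g))) (*-congˡ (average-cong n (reflexive ∘ f≡h)))

  average-when-∈ : ∀ {n} (v : Fin n) x → average n (λ A → when (v ∈ˢ A) x) ≈ ½ * x
  average-when-∈ {suc n} zero x = begin-equality
    average (suc n) (λ A → when (zero ∈ˢ A) x)
      ≈⟨ average-when-suc n (λ A → zero ∈ˢ A) (λ A → when-true here x) (λ A → when-false (λ ()) x) ⟩
    ½ * average n (λ _ → x) + ½ * average n (λ _ → 0#)
      ≈⟨ +-cong (*-congˡ (average-const n x)) (*-congˡ (average-const n 0#)) ⟩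
    ½ * x + ½ * 0#
      ≈⟨ trans (+-congˡ (zeroʳ ½)) (+-identityʳ _) ⟩
    ½ * x ∎
  average-when-∈ {suc n} (suc v) x = begin-equality
    average (suc n) (λ A → when (suc v ∈ˢ A) x)
      ≈⟨ average-when-suc n (λ A → suc v ∈ˢ A) (λ A → when-cong drop-there there x) (λ A → when-cong drop-there there x) ⟩
    ½ * average n (λ A → when (v ∈ˢ A) x) + ½ * average n (λ A → when (v ∈ˢ A) x)
      ≈⟨ ½x+½x≈x _ ⟩
    average n (λ A → when (v ∈ˢ A) x)
      ≈⟨ average-when-∈ v x ⟩
    ½ * x ∎

  average-when-∉ : ∀ {n} (v : Fin n) x → average n (λ A → when (v ∉ˢ A) x) ≈ ½ * x
  average-when-∉ {n} v x = antisym (+-cancelˡ-≤ (½ * x) (≤-reflexive both)) (+-cancelˡ-≤ (½ * x) (≤-reflexive (sym both)))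
    where
    complementary : ∀ A → x ≈ when (v ∈ˢ A) x + when (v ∉ˢ A) x
    complementary A with em {P = v ∈ˢ A}
    ... | yes v∈A = sym (trans (+-congˡ (reflexive (when-false (λ v∉A → v∉A v∈A) x))) (+-identityʳ x))
    ... | no  v∉A = sym (trans (+-congˡ (reflexive (when-true v∉A x))) (+-identityˡ x))
    both : ½ * x + average n (λ A → when (v ∉ˢ A) x) ≈ ½ * x + ½ * x
    both = begin-equality
      ½ * x + average n (λ A → when (v ∉ˢ A) x)
        ≈⟨ +-congʳ (average-when-∈ v x) ⟨
      average n (λ A → when (v ∈ˢ A) x) + average n (λ A → when (v ∉ˢ A) x)
        ≈⟨ average-+ n _ _ ⟨
      average n (λ A → when (v ∈ˢ A) x + when (v ∉ˢ A) x)
        ≈⟨ average-cong n complementary ⟨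
      average n (λ A → x) ≈⟨ average-const n x ⟩
      x ≈⟨ ½x+½x≈x x ⟨
      ½ * x + ½ * x ∎

  -- Distinct vertices get independent coins, each contributing a factor ½. For equal vertices the
  -- condition is contradictory, which is why the charging must know that forest edges are not
  -- loops.
  average-when-∉-∈ : ∀ {n} {u v : Fin n} → u ≢ v → ∀ x →
    average n (λ A → when (u ∉ˢ A × v ∈ˢ A) x) ≈ ½ * (½ * x)
  average-when-∉-∈ {suc n} {zero} {zero} u≢v x = ⊥-elim (u≢v ≡.refl)
  average-when-∉-∈ {suc n} {zero} {suc v} u≢v x = begin-equality
    average (suc n) (λ A → when (zero ∉ˢ A × suc v ∈ˢ A) x)
      ≈⟨ average-when-suc n (λ A → zero ∉ˢ A × suc v ∈ˢ A) (λ A → when-false (λ (∉ , _) → ∉ here) x)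
           (λ A → when-cong (drop-there ∘ proj₂) (λ v∈A → (λ ()) , there v∈A) x) ⟩
    ½ * average n (λ _ → 0#) + ½ * average n (λ A → when (v ∈ˢ A) x)
      ≈⟨ +-cong (*-congˡ (average-const n 0#)) (*-congˡ (average-when-∈ v x)) ⟩
    ½ * 0# + ½ * (½ * x)
      ≈⟨ trans (+-congʳ (zeroʳ ½)) (+-identityˡ _) ⟩
    ½ * (½ * x) ∎
  average-when-∉-∈ {suc n} {suc u} {zero} u≢v x = begin-equality
    average (suc n) (λ A → when (suc u ∉ˢ A × zero ∈ˢ A) x)
      ≈⟨ average-when-suc n (λ A → suc u ∉ˢ A × zero ∈ˢ A) (λ A → when-cong (λ (∉ , _) → ∉ ∘ there) (λ ∉ → ∉ ∘ drop-there , here) x)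
           (λ A → when-false (λ { (_ , ()) }) x) ⟩
    ½ * average n (λ A → when (u ∉ˢ A) x) + ½ * average n (λ _ → 0#)
      ≈⟨ +-cong (*-congˡ (average-when-∉ u x)) (*-congˡ (average-const n 0#)) ⟩
    ½ * (½ * x) + ½ * 0#
      ≈⟨ trans (+-congˡ (zeroʳ ½)) (+-identityʳ _) ⟩
    ½ * (½ * x) ∎
  average-when-∉-∈ {suc n} {suc u} {suc v} u≢v x = begin-equality
    average (suc n) (λ A → when (suc u ∉ˢ A × suc v ∈ˢ A) x)
      ≈⟨ average-when-suc n (λ A → suc u ∉ˢ A × suc v ∈ˢ A) shift shift ⟩
    ½ * average n (λ A → when (u ∉ˢ A × v ∈ˢ A) x) + ½ * average n (λ A → when (u ∉ˢ A × v ∈ˢ A) x)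
      ≈⟨ ½x+½x≈x _ ⟩
    average n (λ A → when (u ∉ˢ A × v ∈ˢ A) x)
      ≈⟨ average-when-∉-∈ (u≢v ∘ ≡.cong suc) x ⟩
    ½ * (½ * x) ∎
    where
    shift : ∀ {s} A → when (suc u ∉ˢ s Vec.∷ A × suc v ∈ˢ s Vec.∷ A) x ≡ when (u ∉ˢ A × v ∈ˢ A) x
    shift A = when-cong (λ (∉ , ∈) → ∉ ∘ there , drop-there ∈) (λ (∉ , ∈) → ∉ ∘ drop-there , there ∈) x

  -- Estimates for extended values

  ≤⁺-·⁺ : ∀ {c x y} → 0# ≤ c → [ x ] ≤⁺ y → [ c * x ] ≤⁺ c ·⁺ y
  ≤⁺-·⁺ 0≤c AddSupremum.[ x≤y ] = AddSupremum.[ *-monoˡ-≤ 0≤c x≤y ]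
  ≤⁺-·⁺ 0≤c (_ AddSupremum.≤⊤⁺) = _ AddSupremum.≤⊤⁺

  ≤⁺-+⁺ : ∀ {x x′ y y′} → [ x ] ≤⁺ y → [ x′ ] ≤⁺ y′ → [ x + x′ ] ≤⁺ y +⁺ y′
  ≤⁺-+⁺ AddSupremum.[ p ] AddSupremum.[ q ] = AddSupremum.[ +-mono-≤ p q ]
  ≤⁺-+⁺ AddSupremum.[ p ] (_ AddSupremum.≤⊤⁺) = _ AddSupremum.≤⊤⁺
  ≤⁺-+⁺ (_ AddSupremum.≤⊤⁺) _ = _ AddSupremum.≤⊤⁺

  -- For finite `e` every approximant `y`, which may vary with `δ`, is replaced by the one bound
  -- `e`; what remains is the statement for reals.
  ≤⁺-byEpsilon : ∀ {c x e} → 0# ≤ c →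
    (∀ δ → 0# < δ → ∃ λ y → [ y ] ≤⁺ e × x ≤ y + c * δ) → [ x ] ≤⁺ e
  ≤⁺-byEpsilon {e = ⊤⁺}    0≤c approx = _ AddSupremum.≤⊤⁺
  ≤⁺-byEpsilon {e = [ r ]} 0≤c approx = AddSupremum.[ ≤-byEpsilon 0≤c (λ δ 0<δ →
    let (y , y≤r , x≤) = approx δ 0<δ in
    ≤-trans x≤ (+-monoˡ-≤ _ (AddSupremum.[≤]-injective _≤_ y≤r))) ]

  -- Rounding down by a sum of indicators of rays

  module Staircase (δ : Carrier) (0≤δ : 0# ≤ δ) where
    -- The largest k δ with k ≤ N and t + k δ ≤ x (0 if x < t).
    stair : ℕ → Carrier → Carrier → Carrier
    stair zero    t x = 0#
    stair (suc N) t x = δ * 𝟙 (t + δ ≤ x) + stair N (t + δ) x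

    stair-nonNeg : ∀ N t x → 0# ≤ stair N t x
    stair-nonNeg zero    t x = ≤-refl
    stair-nonNeg (suc N) t x =
      +-nonNeg (*-nonNeg 0≤δ (when-nonNeg λ _ → 0≤1)) (stair-nonNeg N (t + δ) x)

    stair≈0 : ∀ N {t x} → ¬ (t + δ ≤ x) → stair N t x ≈ 0#
    stair≈0 zero    t+δ≰x = refl
    stair≈0 (suc N) {t} {x} t+δ≰x = begin-equality
      δ * 𝟙 (t + δ ≤ x) + stair N (t + δ) x
        ≈⟨ +-cong (*-congˡ (reflexive (when-false t+δ≰x 1#))) (stair≈0 N (t+δ≰x ∘ ≤-trans (x≤x+y 0≤δ))) ⟩
      δ * 0# + 0# ≈⟨ trans (+-identityʳ _) (zeroʳ δ) ⟩
      0#          ∎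

    t+stair≤x : ∀ N {t x} → t ≤ x → t + stair N t x ≤ x
    t+stair≤x zero    t≤x = ≤-respˡ-≈ (sym (+-identityʳ _)) t≤x
    t+stair≤x (suc N) {t} {x} t≤x = byCases (em {P = t + δ ≤ x})
      where
      byCases : Dec (t + δ ≤ x) → t + stair (suc N) t x ≤ x
      byCases (no t+δ≰x)  = ≤-respˡ-≈ (sym (trans (+-congˡ (stair≈0 (suc N) t+δ≰x)) (+-identityʳ t))) t≤x
      byCases (yes t+δ≤x) = begin
        t + (δ * 𝟙 (t + δ ≤ x) + stair N (t + δ) x)
          ≈⟨ +-congˡ (+-congʳ (trans (*-congˡ (reflexive (when-true t+δ≤x 1#))) (*-identityʳ δ))) ⟩
        t + (δ + stair N (t + δ) x) ≈⟨ +-assoc t δ _ ⟨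
        t + δ + stair N (t + δ) x   ≤⟨ t+stair≤x N t+δ≤x ⟩
        x ∎

    -- Each climbed step raises `t` by `δ`, until `x` lies below the next level and the spare `δ`
    -- covers the remainder. If all `N` steps are climbed, the cap `t + N · δ` on `z` takes over.
    z≤t+δ+stair : ∀ N {t x z} → z ≤ x → z ≤ t + N · δ → z ≤ t + δ + stair N t x
    z≤t+δ+stair zero    {t} z≤x z≤t = ≤-trans z≤t
      (≤-respʳ-≈ (sym (+-identityʳ _)) (+-monoʳ-≤ t 0≤δ))
    z≤t+δ+stair (suc N) {t} {x} {z} z≤x z≤t = byCases (em {P = t + δ ≤ x})
      where
      byCases : Dec (t + δ ≤ x) → z ≤ t + δ + stair (suc N) t x
      byCases (no t+δ≰x)  = ≤-trans z≤x (≤-trans (≰⇒≥ t+δ≰x) (x≤x+y (stair-nonNeg (suc N) t x)))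
      byCases (yes t+δ≤x) = begin
        z ≤⟨ z≤t+δ+stair N z≤x (≤-respʳ-≈ (sym (+-assoc t δ _)) z≤t) ⟩
        t + δ + δ + stair N (t + δ) x ≈⟨ +-assoc _ δ _ ⟩
        t + δ + (δ + stair N (t + δ) x)
          ≈⟨ +-congˡ (+-congʳ (trans (*-congˡ (reflexive (when-true t+δ≤x 1#))) (*-identityʳ δ))) ⟨
        t + δ + (δ * 𝟙 (t + δ ≤ x) + stair N (t + δ) x) ∎

-- Closure properties shared by events and Borel sets

module SigmaAlgebra (em : ∀ {ℓ} → ExcludedMiddle ℓ) {Ω : Set} (𝒮 : Pred Ω 0ℓ → Set₁)
  (resp : ∀ {A B} → A ≐ B → 𝒮 A → 𝒮 B)
  (complement : ∀ {A} → 𝒮 A → 𝒮 (∁ A))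
  (union : ∀ {A : ℕ → Pred Ω 0ℓ} → (∀ i → 𝒮 (A i)) → 𝒮 (⋃ ℕ A))
  where

  ∪-closed : ∀ {A B} → 𝒮 A → 𝒮 B → 𝒮 (A ∪ B)
  ∪-closed {A} {B} a b = resp
    ( (λ { (zero , x) → inj₁ x ; (suc _ , x) → inj₂ x })
    , (λ { (inj₁ x) → 0 , x ; (inj₂ x) → 1 , x }))
    (union {λ { zero → A ; (suc _) → B }} λ { zero → a ; (suc _) → b })

  ∩-closed : ∀ {A B} → 𝒮 A → 𝒮 B → 𝒮 (A ∩ B)
  ∩-closed a b = resp
    ( (λ ¬¬ → decidable-stable em (¬¬ ∘ inj₁) , decidable-stable em (¬¬ ∘ inj₂))
    , (λ (x , y) → [ (λ ¬x → ¬x x) , (λ ¬y → ¬y y) ]′))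
    (complement (∪-closed (complement a) (complement b)))

  U-closed : ∀ {A} → 𝒮 A → 𝒮 U
  U-closed {A} a = resp ((λ _ → tt) , λ {x} _ → case x) (∪-closed a (complement a))
    where
    case : ∀ x → A x ⊎ ¬ A x
    case x with em {P = A x}
    ... | yes p = inj₁ p
    ... | no ¬p = inj₂ ¬p

  -- The premise does not depend on the point, so the set is either `A` or everything. This is how a
  -- constraint is imposed at selected indices of a family only.
  ⇒-closed : ∀ {A P} → 𝒮 A → 𝒮 (λ x → P → A x)
  ⇒-closed {P = P} a with em {P = P}
  ... | yes p = resp ((λ x _ → x) , λ f → f p) a
  ... | no ¬p = resp ((λ _ p → ⊥-elim (¬p p)) , _) (U-closed a)

  ⋂-closed : ∀ {k} {A : Fin k → Pred Ω 0ℓ} → 𝒮 U → (∀ i → 𝒮 (A i)) → 𝒮 (⋂ (Fin k) A)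
  ⋂-closed {zero}  u a = resp ((λ _ ()) , _) u
  ⋂-closed {suc k} u a = resp
    ((λ { (x , xs) zero → x ; (x , xs) (suc i) → xs i }) , λ xs → xs zero , xs ∘ suc)
    (∩-closed (a zero) (⋂-closed u (a ∘ suc)))

-- Finite additivity and integrals of simple functions

module Measure (em : ∀ {ℓ} → ExcludedMiddle ℓ) (ℝ : CompleteOrderedField) (𝒫 : ProbabilitySpace ℝ) where
  open CompleteOrderedField ℝ hiding (zero)
  open ProbabilitySpace 𝒫
  open Expectation em ℝ 𝒫
  open OrderedField em ℝ
  open ≤-Reasoning

  module Events = SigmaAlgebra em Event Event-resp Event-∁ Event-⋃
  module Borels = SigmaAlgebra em Borel resp complement union

  Event-∅ : Event ∅
  Event-∅ = Event-resp ((λ ¬tt → ¬tt tt) , λ ()) (Event-∁ Event-U)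

  -- For the constant sequence of empty sets, a partial sum of two terms is at most the probability
  -- of the union: `p + p ≤ p`.
  Pr-∅ : Pr ∅ ≈ 0#
  Pr-∅ = antisym (x+x≤x⇒x≤0 (begin
    Pr ∅ + Pr ∅        ≈⟨ +-congˡ (+-identityʳ _) ⟨
    Pr ∅ + (Pr ∅ + 0#) ≤⟨ proj₁ (Pr-additive {λ _ → ∅} (λ _ → Event-∅) (λ _ _ ())) _ (2 , refl) ⟩
    Pr (⋃ ℕ λ _ → ∅)   ≈⟨ Pr-cong Event-∅ ((λ ()) , λ ()) ⟨
    Pr ∅               ∎)) (Pr-nonNeg Event-∅)

  Pr-∪ : ∀ {A B} → Event A → Event B → A ⊥′ B → Pr (A ∪ B) ≈ Pr A + Pr B
  Pr-∪ {A} {B} a b disjoint = antisym upper lower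
    where
    S : ℕ → Pred Ω 0ℓ
    S 0 = A
    S 1 = B
    S (suc (suc _)) = ∅
    event : ∀ i → Event (S i)
    event 0 = a
    event 1 = b
    event (suc (suc _)) = Event-∅
    S-disjoint : ∀ {i j} → i ≢ j → S i ⊥′ S j
    S-disjoint {0} {0} 0≢0 _ _ = 0≢0 ≡.refl
    S-disjoint {0} {1} _ = disjoint
    S-disjoint {1} {0} _ x = disjoint x ∘ swap
    S-disjoint {1} {1} 1≢1 _ _ = 1≢1 ≡.refl
    S-disjoint {suc (suc _)} {_} _ _ ()
    S-disjoint {0} {suc (suc _)} _ _ ()
    S-disjoint {1} {suc (suc _)} _ _ ()
    supremum : IsSupremum (λ s → ∃ λ k → s ≈ sum {k} (λ i → Pr (S (toℕ i)))) (Pr (⋃ ℕ S))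
    supremum = Pr-additive event S-disjoint
    ≐⋃ : (A ∪ B) ≐ ⋃ ℕ S
    ≐⋃ = (λ { (inj₁ x) → 0 , x ; (inj₂ x) → 1 , x })
       , (λ { (0 , x) → inj₁ x ; (1 , x) → inj₂ x ; (suc (suc _) , ()) })
    partial : ∀ k → sum {k} (λ i → Pr (S (toℕ i))) ≤ Pr A + Pr B
    partial 0 = +-nonNeg (Pr-nonNeg a) (Pr-nonNeg b)
    partial 1 = +-monoʳ-≤ (Pr A) (Pr-nonNeg b)
    partial (suc (suc k)) = +-monoʳ-≤ (Pr A) (≤-respʳ-≈ (+-identityʳ _)
      (+-monoʳ-≤ (Pr B) (sum-nonPos {k} (λ _ → ≤-reflexive Pr-∅))))
    upper : Pr (A ∪ B) ≤ Pr A + Pr B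
    upper = begin
      Pr (A ∪ B) ≈⟨ Pr-cong (Events.∪-closed a b) ≐⋃ ⟩
      Pr (⋃ ℕ S) ≤⟨ proj₂ supremum _ (λ { x (k , x≈) → ≤-respˡ-≈ (sym x≈) (partial k) }) ⟩
      Pr A + Pr B ∎
    lower : Pr A + Pr B ≤ Pr (A ∪ B)
    lower = begin
      Pr A + Pr B        ≈⟨ +-congˡ (+-identityʳ _) ⟨
      Pr A + (Pr B + 0#) ≤⟨ proj₁ supremum _ (2 , refl) ⟩
      Pr (⋃ ℕ S)         ≈⟨ Pr-cong (Events.∪-closed a b) ≐⋃ ⟨
      Pr (A ∪ B) ∎

  Pr-split : ∀ {E A} → Event E → Event A → Pr E ≈ Pr (E ∩ A) + Pr (E ∩ ∁ A)
  Pr-split {E} {A} e a = begin-equality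
    Pr E                        ≈⟨ Pr-cong e (split , [ proj₁ , proj₁ ]′) ⟩
    Pr ((E ∩ A) ∪ (E ∩ ∁ A))    ≈⟨ Pr-∪ (Events.∩-closed e a) (Events.∩-closed e (Event-∁ a))
                                     (λ _ ((_ , x) , (_ , ¬x)) → ¬x x) ⟩
    Pr (E ∩ A) + Pr (E ∩ ∁ A)   ∎
    where
    split : E ⊆ ((E ∩ A) ∪ (E ∩ ∁ A))
    split {ω} x with em {P = A ω}
    ... | yes y = inj₁ (x , y)
    ... | no ¬y = inj₂ (x , ¬y)

  Pr-mono : ∀ {A B} → Event A → Event B → A ⊆ B → Pr A ≤ Pr B
  Pr-mono {A} {B} a b A⊆B = begin
    Pr A                      ≈⟨ Pr-cong a ((λ x → A⊆B x , x) , proj₂) ⟩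
    Pr (B ∩ A)                ≤⟨ x≤x+y (Pr-nonNeg (Events.∩-closed b (Event-∁ a))) ⟩
    Pr (B ∩ A) + Pr (B ∩ ∁ A) ≈⟨ Pr-split b a ⟨
    Pr B                      ∎

  Pr-∁ : ∀ {A} → Event A → Pr A + Pr (∁ A) ≈ 1#
  Pr-∁ {A} a = begin-equality
    Pr A + Pr (∁ A)             ≈⟨ +-cong (Pr-cong a ((λ x → tt , x) , proj₂)) (Pr-cong (Event-∁ a) ((λ x → tt , x) , proj₂)) ⟩
    Pr (U ∩ A) + Pr (U ∩ ∁ A)   ≈⟨ Pr-split Event-U a ⟨
    Pr U                        ≈⟨ Pr-U ⟩
    1# ∎

  Term : Set₁
  Term = Carrier × Pred Ω 0ℓ

  -- One fold for several functionals: `Pr` gives the integral, the indicators at `ω` give the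
  -- value, and `λ A → Pr (E ∩ A)` gives the integral over `E`. Coefficients may be negative here,
  -- unlike in `SimpleFunction`.
  evaluate : (Pred Ω 0ℓ → Carrier) → List Term → Carrier
  evaluate φ = List.foldr (λ (c , A) s → c * φ A + s) 0#

  evaluate-++ : ∀ φ ts us → evaluate φ (ts ++ us) ≈ evaluate φ ts + evaluate φ us
  evaluate-++ φ []             us = sym (+-identityˡ _)
  evaluate-++ φ ((c , A) ∷ ts) us =
    trans (+-congˡ (evaluate-++ φ ts us)) (sym (+-assoc _ _ _))

  scale : Carrier → List Term → List Term
  scale c = List.map (λ (d , A) → c * d , A)

  evaluate-scale : ∀ φ c ts → evaluate φ (scale c ts) ≈ c * evaluate φ ts
  evaluate-scale φ c []             = sym (zeroʳ c)
  evaluate-scale φ c ((d , A) ∷ ts) = begin-equality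
    c * d * φ A + evaluate φ (scale c ts) ≈⟨ +-cong (*-assoc c d (φ A)) (evaluate-scale φ c ts) ⟩
    c * (d * φ A) + c * evaluate φ ts     ≈⟨ distribˡ c _ _ ⟨
    c * (d * φ A + evaluate φ ts)         ∎

  evaluate-cong : ∀ {φ ψ} ts → All (λ (_ , A) → φ A ≈ ψ A) ts → evaluate φ ts ≈ evaluate ψ ts
  evaluate-cong []       []       = refl
  evaluate-cong (_ ∷ ts) (p ∷ ps) = +-cong (*-congˡ p) (evaluate-cong ts ps)

  evaluate-+ : ∀ φ ψ ts → evaluate (λ A → φ A + ψ A) ts ≈ evaluate φ ts + evaluate ψ ts
  evaluate-+ φ ψ []             = sym (+-identityˡ 0#)
  evaluate-+ φ ψ ((c , A) ∷ ts) = trans (+-congˡ (evaluate-+ φ ψ ts))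
    (solve 5 (λ c x y s t → c :* (x :+ y) :+ (s :+ t) := (c :* x :+ s) :+ (c :* y :+ t)) refl c _ _ _ _)

  -- Splitting E along the first term's event turns its coefficient into a
  -- constant on each piece, which the accumulator a collects.
  localIntegral-nonNeg : ∀ {E} ts a → Event E → All (Event ∘ proj₂) ts →
    (∀ ω → E ω → 0# ≤ a + evaluate (λ A → 𝟙 (A ω)) ts) →
    0# ≤ a * Pr E + evaluate (λ A → Pr (E ∩ A)) ts
  localIntegral-nonNeg {E} [] a e [] 0≤ with em {P = ∃ E}
  ... | yes (ω , x) = ≤-respʳ-≈ (sym (+-identityʳ _))
    (*-nonNeg (≤-respʳ-≈ (+-identityʳ a) (0≤ ω x)) (Pr-nonNeg e))
  -- An empty piece says nothing about the sign of `a`, but its probability is zero.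
  ... | no empty = ≤-reflexive (sym (begin-equality
    a * Pr E + 0# ≈⟨ +-identityʳ _ ⟩
    a * Pr E      ≈⟨ *-congˡ (Pr-cong e ((λ x → empty (_ , x)) , λ ())) ⟩
    a * Pr ∅      ≈⟨ *-congˡ Pr-∅ ⟩
    a * 0#        ≈⟨ zeroʳ a ⟩
    0#            ∎))
  localIntegral-nonNeg {E} ((c , A) ∷ ts) a e (A-event ∷ events) 0≤ = begin
    0# ≤⟨ +-nonNeg
            (localIntegral-nonNeg ts (a + c) (Events.∩-closed e A-event) events inA)
            (localIntegral-nonNeg ts a (Events.∩-closed e (Event-∁ A-event)) events outA) ⟩
    ((a + c) * Pr (E ∩ A) + evaluate (λ B → Pr ((E ∩ A) ∩ B)) ts) +
    (a * Pr (E ∩ ∁ A) + evaluate (λ B → Pr ((E ∩ ∁ A) ∩ B)) ts)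
      ≈⟨ solve 6 (λ a c p q s t → ((a :+ c) :* p :+ s) :+ (a :* q :+ t) :=
                                  a :* (p :+ q) :+ (c :* p :+ (s :+ t))) refl a c _ _ _ _ ⟩
    a * (Pr (E ∩ A) + Pr (E ∩ ∁ A)) + (c * Pr (E ∩ A) +
      (evaluate (λ B → Pr ((E ∩ A) ∩ B)) ts + evaluate (λ B → Pr ((E ∩ ∁ A) ∩ B)) ts))
      ≈⟨ +-cong (*-congˡ (Pr-split e A-event)) (+-congˡ (evaluate-+ _ _ ts)) ⟨
    a * Pr E + (c * Pr (E ∩ A) + evaluate (λ B → Pr ((E ∩ A) ∩ B) + Pr ((E ∩ ∁ A) ∩ B)) ts)
      ≈⟨ +-congˡ (+-congˡ (evaluate-cong ts (All.map (λ {t} → regroup {t}) events))) ⟨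
    a * Pr E + (c * Pr (E ∩ A) + evaluate (λ B → Pr (E ∩ B)) ts) ∎
    where
    regroup : ∀ {t : Term} → Event (proj₂ t) →
      Pr (E ∩ proj₂ t) ≈ Pr ((E ∩ A) ∩ proj₂ t) + Pr ((E ∩ ∁ A) ∩ proj₂ t)
    regroup b = trans (Pr-split (Events.∩-closed e b) A-event) (+-cong
      (Pr-cong (Events.∩-closed (Events.∩-closed e b) A-event) (exchange , exchange))
      (Pr-cong (Events.∩-closed (Events.∩-closed e b) (Event-∁ A-event)) (exchange , exchange)))
      where
      exchange : ∀ {P Q R : Set} → (P × Q) × R → (P × R) × Q
      exchange ((p , q) , r) = (p , r) , q
    inA : ∀ ω → (E ∩ A) ω → 0# ≤ a + c + evaluate (λ B → 𝟙 (B ω)) ts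
    inA ω (x , y) = ≤-respʳ-≈
      (trans (sym (+-assoc _ _ _)) (+-congʳ (+-congˡ (trans (*-congˡ (reflexive (when-true y 1#))) (*-identityʳ c)))))
      (0≤ ω x)
    outA : ∀ ω → (E ∩ ∁ A) ω → 0# ≤ a + evaluate (λ B → 𝟙 (B ω)) ts
    outA ω (x , ¬y) = ≤-respʳ-≈
      (+-congˡ (trans (+-congʳ (trans (*-congˡ (reflexive (when-false ¬y 1#))) (zeroʳ c))) (+-identityˡ _)))
      (0≤ ω x)

  -- Ties an integral to a function rather than to one list of terms; by `integral-mono` the number
  -- `x` does not depend on the representation.
  record HasIntegral (f : Ω → Carrier) (x : Carrier) : Set₁ where
    field
      simple    : SimpleFunction
      value≈    : ∀ ω → SimpleFunction.value simple ω ≈ f ω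
      integral≈ : SimpleFunction.integral simple ≈ x
    open SimpleFunction simple public

  -- The difference `g - f` is a list of terms with signed coefficients and nonnegative values, so
  -- `localIntegral-nonNeg` applies to it on the whole space with accumulator zero.
  integral-mono : ∀ {f g x y} → HasIntegral f x → HasIntegral g y → (∀ ω → f ω ≤ g ω) → x ≤ y
  integral-mono {f} {g} {x} {y} F G f≤g = +-cancelˡ-≤ (- x) (begin
    - x + x ≈⟨ -‿inverseˡ x ⟩
    0# ≤⟨ localIntegral-nonNeg difference 0# Event-U difference-events difference-nonNeg ⟩
    0# * Pr U + evaluate (λ A → Pr (U ∩ A)) difference
      ≈⟨ trans (+-congʳ (zeroˡ _)) (+-identityˡ _) ⟩
    evaluate (λ A → Pr (U ∩ A)) difference
      ≈⟨ evaluate-cong difference (All.map (λ a → Pr-cong a ((λ z → tt , z) , proj₂)) difference-events) ⟨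
    evaluate Pr difference ≈⟨ evaluate-difference Pr ⟩
    - 1# * evaluate Pr F.terms + evaluate Pr G.terms ≈⟨ +-cong (*-congˡ F.integral≈) G.integral≈ ⟩
    - 1# * x + y ≈⟨ +-congʳ (-1*x≈-x x) ⟩
    - x + y ∎)
    where
    module F = HasIntegral F
    module G = HasIntegral G
    difference : List Term
    difference = scale (- 1#) F.terms ++ G.terms
    evaluate-difference : ∀ φ → evaluate φ difference ≈ - 1# * evaluate φ F.terms + evaluate φ G.terms
    evaluate-difference φ = trans (evaluate-++ φ (scale (- 1#) F.terms) G.terms)
      (+-congʳ (evaluate-scale φ (- 1#) F.terms))
    difference-events : All (Event ∘ proj₂) difference
    difference-events = All.++⁺ (All.map⁺ F.events) G.events
    difference-nonNeg : ∀ ω → U ω → 0# ≤ 0# + evaluate (λ A → 𝟙 (A ω)) difference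
    difference-nonNeg ω _ = begin
      0#               ≈⟨ -‿inverseˡ (f ω) ⟨
      - f ω + f ω      ≤⟨ +-monoʳ-≤ (- f ω) (f≤g ω) ⟩
      - f ω + g ω      ≈⟨ +-congʳ (-1*x≈-x (f ω)) ⟨
      - 1# * f ω + g ω ≈⟨ +-cong (*-congˡ (F.value≈ ω)) (G.value≈ ω) ⟨
      - 1# * F.value ω + G.value ω ≈⟨ evaluate-difference (λ A → 𝟙 (A ω)) ⟨
      evaluate (λ A → 𝟙 (A ω)) difference ≈⟨ +-identityˡ _ ⟨
      0# + evaluate (λ A → 𝟙 (A ω)) difference ∎

  integral-resp : ∀ {f g x y} → (∀ ω → f ω ≈ g ω) → x ≈ y → HasIntegral f x → HasIntegral g y
  integral-resp f≈g x≈y F = record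
    { simple = F.simple
    ; value≈ = λ ω → trans (F.value≈ ω) (f≈g ω)
    ; integral≈ = trans F.integral≈ x≈y
    } where module F = HasIntegral F

  integral-𝟙 : ∀ {A} → Event A → HasIntegral (λ ω → 𝟙 (A ω)) (Pr A)
  integral-𝟙 {A} a = record
    { simple = record { terms = (1# , A) ∷ [] ; nonNeg = 0≤1 ∷ [] ; events = a ∷ [] }
    ; value≈ = λ ω → trans (+-identityʳ _) (*-identityˡ _)
    ; integral≈ = trans (+-identityʳ _) (*-identityˡ _)
    }

  integral-+ : ∀ {f g x y} → HasIntegral f x → HasIntegral g y → HasIntegral (λ ω → f ω + g ω) (x + y)
  integral-+ F G = record
    { simple = record
      { terms  = F.terms ++ G.terms
      ; nonNeg = All.++⁺ F.nonNeg G.nonNeg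
      ; events = All.++⁺ F.events G.events
      }
    ; value≈ = λ ω → trans (evaluate-++ (λ A → 𝟙 (A ω)) F.terms G.terms) (+-cong (F.value≈ ω) (G.value≈ ω))
    ; integral≈ = trans (evaluate-++ Pr F.terms G.terms) (+-cong F.integral≈ G.integral≈)
    }
    where
    module F = HasIntegral F
    module G = HasIntegral G

  integral-* : ∀ {c f x} → 0# ≤ c → HasIntegral f x → HasIntegral (λ ω → c * f ω) (c * x)
  integral-* {c} 0≤c F = record
    { simple = record
      { terms  = scale c F.terms
      ; nonNeg = All.map⁺ (All.map (*-nonNeg 0≤c) F.nonNeg)
      ; events = All.map⁺ F.events
      }
    ; value≈ = λ ω → trans (evaluate-scale (λ A → 𝟙 (A ω)) c F.terms) (*-congˡ (F.value≈ ω))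
    ; integral≈ = trans (evaluate-scale Pr c F.terms) (*-congˡ F.integral≈)
    } where module F = HasIntegral F

  integral-0 : HasIntegral (λ _ → 0#) 0#
  integral-0 = record
    { simple = record { terms = [] ; nonNeg = [] ; events = [] }
    ; value≈ = λ _ → refl
    ; integral≈ = refl
    }

  integral-const : ∀ {c} → 0# ≤ c → HasIntegral (λ _ → c) c
  integral-const {c} 0≤c = integral-resp
    (λ ω → trans (*-congˡ (reflexive (when-true tt 1#))) (*-identityʳ c))
    (trans (*-congˡ Pr-U) (*-identityʳ c))
    (integral-* 0≤c (integral-𝟙 Event-U))

  integral-sum : ∀ {k} {f : Fin k → Ω → Carrier} {x : Fin k → Carrier} →
    (∀ i → HasIntegral (f i) (x i)) → HasIntegral (λ ω → sum (λ i → f i ω)) (sum x)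
  integral-sum {zero}  F = integral-0
  integral-sum {suc k} F = integral-+ (F zero) (integral-sum (F ∘ suc))

  integral-when : ∀ {P f x} → (P → HasIntegral f x) → HasIntegral (λ ω → when P (f ω)) (when P x)
  integral-when {P} F with em {P = P}
  ... | yes p = F p
  ... | no _  = integral-0

  integral-average : ∀ n {f : Subset n → Ω → Carrier} {x : Subset n → Carrier} →
    (∀ A → HasIntegral (f A) (x A)) → HasIntegral (λ ω → average n (λ A → f A ω)) (average n x)
  integral-average zero    F = F Vec.[]
  integral-average (suc n) F = integral-+
    (integral-* 0≤½ (integral-average n λ A → F (inside Vec.∷ A)))
    (integral-* 0≤½ (integral-average n λ A → F (outside Vec.∷ A)))

  simple-bounded : ∀ (s : SimpleFunction) → ∃ λ K → 0# ≤ K × (∀ ω → SimpleFunction.value s ω ≤ K)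
  -- The bound is the sum of all coefficients, as if every event occurred at once.
  simple-bounded s = evaluate (λ _ → 1#) terms , nonNegative terms nonNeg , λ ω → bound terms nonNeg
    where
    open SimpleFunction s
    nonNegative : ∀ ts → All (λ t → 0# ≤ proj₁ t) ts → 0# ≤ evaluate (λ _ → 1#) ts
    nonNegative [] [] = ≤-refl
    nonNegative (_ ∷ ts) (0≤c ∷ ps) = +-nonNeg (*-nonNeg 0≤c 0≤1) (nonNegative ts ps)
    bound : ∀ {ω} ts → All (λ t → 0# ≤ proj₁ t) ts →
      evaluate (λ A → 𝟙 (A ω)) ts ≤ evaluate (λ _ → 1#) ts
    bound [] [] = ≤-refl
    bound (_ ∷ ts) (0≤c ∷ ps) = +-mono-≤
      (*-monoˡ-≤ 0≤c (when-elim (_≤ 1#) (λ _ → ≤-refl) (λ _ → 0≤1))) (bound ts ps)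

  ≤𝔼 : ∀ {f g x} → HasIntegral g x → (∀ ω → g ω ≤ f ω) → [ x ] ≤⁺ 𝔼 f
  ≤𝔼 {f} G g≤f with em {P = ∃ (IsSupremum λ x → ∃ λ s →
      (∀ ω → SimpleFunction.value s ω ≤ f ω) × x ≈ SimpleFunction.integral s)}
  ... | yes (s , upper , _) = AddSupremum.[ upper _
    (G.simple , (λ ω → ≤-respˡ-≈ (sym (G.value≈ ω)) (g≤f ω)) , sym G.integral≈) ]
    where module G = HasIntegral G
  ... | no _ = _ AddSupremum.≤⊤⁺

  -- A finite bound makes the set of integrals of minorants bounded, and the zero function makes it
  -- nonempty. Completeness then provides the supremum, so the branch in which `sup⁺` is infinite
  -- cannot occur.
  𝔼≤ : ∀ {f e} → (∀ ω → 0# ≤ f ω) →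
    (∀ s → (∀ ω → SimpleFunction.value s ω ≤ f ω) → [ SimpleFunction.integral s ] ≤⁺ e) → 𝔼 f ≤⁺ e
  𝔼≤ {f} {⊤⁺} 0≤f bound = _ AddSupremum.≤⊤⁺
  𝔼≤ {f} {[ r ]} 0≤f bound with em {P = ∃ (IsSupremum λ x → ∃ λ s →
      (∀ ω → SimpleFunction.value s ω ≤ f ω) × x ≈ SimpleFunction.integral s)}
  ... | yes (s , _ , least) = AddSupremum.[ least r (λ { x (t , t≤f , x≈) →
    ≤-respˡ-≈ (sym x≈) (AddSupremum.[≤]-injective _≤_ (bound t t≤f)) }) ]
  ... | no unbounded = ⊥-elim (unbounded (complete _
    (0# , HasIntegral.simple integral-0 , 0≤f , refl)
    (r , λ { x (t , t≤f , x≈) → ≤-respˡ-≈ (sym x≈) (AddSupremum.[≤]-injective _≤_ (bound t t≤f)) })))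

  average≤𝔼-subset : ∀ n {g : Subset n → Carrier} {h : Subset n → Extended} →
    (∀ A → [ g A ] ≤⁺ h A) → [ average n g ] ≤⁺ 𝔼-subset h
  average≤𝔼-subset zero    g≤h = g≤h Vec.[]
  average≤𝔼-subset (suc n) g≤h = ≤⁺-+⁺
    (≤⁺-·⁺ 0≤½ (average≤𝔼-subset n λ A → g≤h (inside Vec.∷ A)))
    (≤⁺-·⁺ 0≤½ (average≤𝔼-subset n λ A → g≤h (outside Vec.∷ A)))

  -- Borel sets of the line

  Borel-U : Borel U
  Borel-U = Borels.U-closed (ray 0#)

  -- The open ray is the union of the closed rays from `a + 1 / (k + 1)`; the Archimedean property
  -- shows that they exhaust it.
  Borel-> : ∀ a → Borel (a <_)
  Borel-> a = resp (below , above) (union λ k → ray (a + fromℕ (suc k) ⁻¹))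
    where
    positive : ∀ k → 0# < fromℕ (suc k) ⁻¹
    positive k = ⁻¹-nonNeg (fromℕ-nonNeg (suc k)) nonZero , λ 0≈ → 0≉1 (begin-equality
      0# ≈⟨ zeroʳ (fromℕ (suc k)) ⟨
      fromℕ (suc k) * 0# ≈⟨ *-congˡ 0≈ ⟩
      fromℕ (suc k) * fromℕ (suc k) ⁻¹ ≈⟨ *-inverseʳ _ nonZero ⟩
      1# ∎)
      where
      nonZero : ¬ (fromℕ (suc k) ≈ 0#)
      nonZero = 1+x≉0 (fromℕ-nonNeg k)
    below : ⋃ ℕ (λ k → a + fromℕ (suc k) ⁻¹ ≤_) ⊆ (a <_)
    below {x} (k , le) = <-≤-trans
      ( x≤x+y (proj₁ (positive k))
      , λ a≈ → proj₂ (positive k) (antisym (proj₁ (positive k))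
          (+-cancelˡ-≤ a (≤-reflexive (trans (sym a≈) (sym (+-identityʳ a)))))))
      le
    above : (a <_) ⊆ ⋃ ℕ (λ k → a + fromℕ (suc k) ⁻¹ ≤_)
    above {x} (a≤x , a≉x) = reciprocal (archimedean (0≤d , 0≉d) 1#)
      where
      d : Carrier
      d = - a + x
      0≤d : 0# ≤ d
      0≤d = ≤-respˡ-≈ (-‿inverseˡ a) (+-monoʳ-≤ (- a) a≤x)
      0≉d : ¬ (0# ≈ d)
      0≉d 0≈d = a≉x (begin-equality
        a       ≈⟨ +-identityʳ a ⟨
        a + 0#  ≈⟨ +-congˡ 0≈d ⟩
        a + d   ≈⟨ x+[-x+y]≈y a x ⟩
        x       ∎)
      reciprocal : (∃ λ N → 1# ≤ N · d) → ⋃ ℕ (λ k → a + fromℕ (suc k) ⁻¹ ≤_) x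
      -- From `1 ≤ N d` follows `1 / (N + 1) ≤ d`; passing to the successor keeps the denominator
      -- nonzero.
      reciprocal (N , 1≤Nd) = N , (begin
        a + c ⁻¹ ≤⟨ +-monoʳ-≤ a (begin
          c ⁻¹             ≈⟨ *-identityʳ _ ⟨
          c ⁻¹ * 1#        ≤⟨ *-monoˡ-≤ (proj₁ (positive N)) (≤-trans 1≤Nd (x≤y+x 0≤d)) ⟩
          c ⁻¹ * (suc N · d) ≈⟨ *-congˡ (·≈fromℕ* (suc N) d) ⟩
          c ⁻¹ * (c * d)   ≈⟨ *-assoc _ c d ⟨
          c ⁻¹ * c * d     ≈⟨ *-congʳ (trans (*-comm _ c) (*-inverseʳ c (1+x≉0 (fromℕ-nonNeg N)))) ⟩
          1# * d           ≈⟨ *-identityˡ d ⟩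
          d                ∎) ⟩
        a + d ≈⟨ x+[-x+y]≈y a x ⟩
        x     ∎)
        where
        c : Carrier
        c = fromℕ (suc N)

  Borel-≤ : ∀ a → Borel (_≤ a)
  Borel-≤ a = resp (≮⇒≥ , λ x≤a (a≤x , a≉x) → a≉x (antisym a≤x x≤a)) (complement (Borel-> a))

  Borel-≈ : ∀ a → Borel (_≈ a)
  Borel-≈ a = resp ((λ (x≤a , a≤x) → antisym x≤a a≤x) , λ x≈a → ≤-reflexive x≈a , ≤-reflexive (sym x≈a))
    (Borels.∩-closed (Borel-≤ a) (ray a))

  -- Independence of one coordinate from the others

  -- Separates the factor at `i₀` without deleting an index: `g` keeps that position, with the value
  -- of an unconstrained coordinate.
  product-cong-except : ∀ {k} (i₀ : Fin k) {f g : Fin k → Carrier} → g i₀ ≈ 1# →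
    (∀ i → i ≢ i₀ → f i ≈ g i) → product f ≈ f i₀ * product g
  product-cong-except zero {f} {g} g₀≈1 f≈g = *-congˡ (begin-equality
    product (f ∘ suc)          ≈⟨ cong′ (λ i → f≈g (suc i) λ ()) ⟩
    product (g ∘ suc)          ≈⟨ *-identityˡ _ ⟨
    1# * product (g ∘ suc)     ≈⟨ *-congʳ g₀≈1 ⟨
    g zero * product (g ∘ suc) ∎)
    where
    cong′ : ∀ {k} {f g : Fin k → Carrier} → (∀ i → f i ≈ g i) → product f ≈ product g
    cong′ {zero}  f≈g = refl
    cong′ {suc k} f≈g = *-cong (f≈g zero) (cong′ (f≈g ∘ suc))
  product-cong-except (suc i₀) {f} {g} g₀≈1 f≈g = begin-equality
    f zero * product (f ∘ suc)
      ≈⟨ *-cong (f≈g zero λ ()) (product-cong-except i₀ g₀≈1 λ i i≢ → f≈g (suc i) (i≢ ∘ suc-injective)) ⟩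
    g zero * (f (suc i₀) * product (g ∘ suc))
      ≈⟨ solve 3 (λ a b c → a :* (b :* c) := b :* (a :* c)) refl _ _ _ ⟩
    f (suc i₀) * (g zero * product (g ∘ suc)) ∎

  module _ {k} {Z : Vector (Ω → Carrier) k} (Z-rv : ∀ i → RandomVariable (Z i))
           (independent : Independent Z) (i₀ : Fin k) where

    -- Finite disjoint unions of boxes that do not constrain Z i₀.
    data Free : Pred Ω 0ℓ → Set₁ where
      box   : (B : Fin k → Pred Carrier 0ℓ) → (∀ i → Borel (B i)) → (∀ x → B i₀ x) →
              Free (⋂ (Fin k) (λ i → Z i ⊢ B i))
      _⊎ᶠ_  : ∀ {C D} → Free C → Free D → {C ⊥′ D} → Free (C ∪ D)
      respᶠ : ∀ {C D} → C ≐ D → Free C → Free D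

    -- Intersection distributes over disjoint unions and keeps them disjoint. The right argument is
    -- unfolded down to a box before the left one.
    Free-∩ : ∀ {C D} → Free C → Free D → Free (C ∩ D)
    Free-∩ (box B b f) (box B′ b′ f′) = respᶠ
      ((λ xs → proj₁ ∘ xs , proj₂ ∘ xs) , λ (xs , ys) i → xs i , ys i)
      (box (λ i → B i ∩ B′ i) (λ i → Borels.∩-closed (b i) (b′ i)) (λ x → f x , f′ x))
    Free-∩ c (_⊎ᶠ_ d d′ {disjoint}) = respᶠ
      ( [ (λ (x , y) → x , inj₁ y) , (λ (x , y) → x , inj₂ y) ]′
      , (λ { (x , inj₁ y) → inj₁ (x , y) ; (x , inj₂ y) → inj₂ (x , y) }))
      (_⊎ᶠ_ (Free-∩ c d) (Free-∩ c d′) {λ { ω ((_ , y) , (_ , z)) → disjoint ω (y , z) }})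
    Free-∩ c (respᶠ (D⊆D′ , D′⊆D) d) = respᶠ
      ((λ (x , y) → x , D⊆D′ y) , (λ (x , y) → x , D′⊆D y)) (Free-∩ c d)
    Free-∩ (_⊎ᶠ_ c c′ {disjoint}) d@(box _ _ _) = respᶠ
      ( [ (λ (x , y) → inj₁ x , y) , (λ (x , y) → inj₂ x , y) ]′
      , (λ { (inj₁ x , y) → inj₁ (x , y) ; (inj₂ x , y) → inj₂ (x , y) }))
      (_⊎ᶠ_ (Free-∩ c d) (Free-∩ c′ d) {λ { ω ((y , _) , (z , _)) → disjoint ω (y , z) }})
    Free-∩ (respᶠ (C⊆C′ , C′⊆C) c) d@(box _ _ _) = respᶠ
      ((λ (x , y) → C⊆C′ x , y) , (λ (x , y) → C′⊆C x , y)) (Free-∩ c d)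

    Free-U : Free U
    Free-U = respᶠ (_ , _) (box (λ _ → U) (λ _ → Borel-U) _)

    Free-⋂ : ∀ {j} {A : Fin j → Pred Ω 0ℓ} → (∀ i → Free (A i)) → Free (⋂ (Fin j) A)
    Free-⋂ {zero}  a = respᶠ ((λ _ ()) , _) Free-U
    Free-⋂ {suc j} a = respᶠ
      ((λ { (x , xs) zero → x ; (x , xs) (suc i) → xs i }) , λ xs → xs zero , xs ∘ suc)
      (Free-∩ (a zero) (Free-⋂ (a ∘ suc)))

    Free-coordinate : ∀ {i P} → i ≢ i₀ → Borel P → Free (Z i ⊢ P)
    Free-coordinate {i} {P} i≢i₀ p = respᶠ
      ((λ xs → xs i ≡.refl) , λ { x j ≡.refl → x })
      (box (λ j x → j ≡ i → P x) (λ j → Borels.⇒-closed p) (λ { x ≡.refl → ⊥-elim (i≢i₀ ≡.refl) }))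

    Free-event : ∀ {D} → Free D → Event D
    Free-event (box B b _)    = Events.⋂-closed Event-U λ i → Z-rv i (B i) (b i)
    Free-event (c ⊎ᶠ d)       = Events.∪-closed (Free-event c) (Free-event d)
    Free-event (respᶠ C≐D c)  = Event-resp C≐D (Free-event c)

    -- For a box, imposing `C` on the unconstrained coordinate `i₀` gives another box, and the two
    -- product formulas differ only in that factor. Additivity carries the identity over to disjoint
    -- unions.
    Free-independent : ∀ {D C} → Free D → Borel C → Pr ((Z i₀ ⊢ C) ∩ D) ≈ Pr (Z i₀ ⊢ C) * Pr D
    Free-independent {C = C} (box B b f) c = begin-equality
      Pr ((Z i₀ ⊢ C) ∩ ⋂ (Fin k) (λ i → Z i ⊢ B i))
        ≈⟨ Pr-cong (Events.∩-closed (Z-rv i₀ C c) (Free-event (box B b f)))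
             ((λ { (x , xs) i → (λ { ≡.refl → x }) , xs i }) , λ xs → proj₁ (xs i₀) ≡.refl , proj₂ ∘ xs) ⟩
      Pr (⋂ (Fin k) (λ i → Z i ⊢ B′ i)) ≈⟨ independent B′ b′ ⟩
      product (λ i → Pr (Z i ⊢ B′ i))
        ≈⟨ product-cong-except i₀
             (trans (Pr-cong (Z-rv i₀ (B i₀) (b i₀)) (_ , λ _ → f _)) Pr-U)
             (λ i i≢i₀ → Pr-cong (Z-rv i (B′ i) (b′ i)) (proj₂ , λ x → (λ i≡i₀ → ⊥-elim (i≢i₀ i≡i₀)) , x)) ⟩
      Pr (Z i₀ ⊢ B′ i₀) * product (λ i → Pr (Z i ⊢ B i))
        ≈⟨ *-cong (Pr-cong (Z-rv i₀ (B′ i₀) (b′ i₀)) ((λ x → proj₁ x ≡.refl) , λ x → (λ _ → x) , f _))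
                  (sym (independent B b)) ⟩
      Pr (Z i₀ ⊢ C) * Pr (⋂ (Fin k) (λ i → Z i ⊢ B i)) ∎
      where
      B′ : Fin k → Pred Carrier 0ℓ
      B′ i x = (i ≡ i₀ → C x) × B i x
      b′ : ∀ i → Borel (B′ i)
      b′ i = Borels.∩-closed (Borels.⇒-closed c) (b i)
    Free-independent {C = C} (_⊎ᶠ_ {D} {D′} d d′ {disjoint}) c = begin-equality
      Pr (V ∩ (D ∪ D′))
        ≈⟨ Pr-cong (Events.∩-closed v (Events.∪-closed (Free-event d) (Free-event d′)))
             ( (λ { (x , inj₁ y) → inj₁ (x , y) ; (x , inj₂ y) → inj₂ (x , y) })
             , [ (λ (x , y) → x , inj₁ y) , (λ (x , y) → x , inj₂ y) ]′) ⟩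
      Pr ((V ∩ D) ∪ (V ∩ D′))
        ≈⟨ Pr-∪ (Events.∩-closed v (Free-event d)) (Events.∩-closed v (Free-event d′))
             (λ { ω ((_ , y) , (_ , z)) → disjoint ω (y , z) }) ⟩
      Pr (V ∩ D) + Pr (V ∩ D′) ≈⟨ +-cong (Free-independent d c) (Free-independent d′ c) ⟩
      Pr V * Pr D + Pr V * Pr D′ ≈⟨ distribˡ _ _ _ ⟨
      Pr V * (Pr D + Pr D′) ≈⟨ *-congˡ (Pr-∪ (Free-event d) (Free-event d′) disjoint) ⟨
      Pr V * Pr (D ∪ D′) ∎
      where
      V : Pred Ω 0ℓ
      V = Z i₀ ⊢ C
      v : Event V
      v = Z-rv i₀ C c
    Free-independent {C = C} (respᶠ (D⊆D′ , D′⊆D) d) c = begin-equality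
      Pr ((Z i₀ ⊢ C) ∩ _) ≈⟨ Pr-cong (Events.∩-closed (Z-rv i₀ C c) (Free-event d))
                               ((λ (x , y) → x , D⊆D′ y) , (λ (x , y) → x , D′⊆D y)) ⟨
      Pr ((Z i₀ ⊢ C) ∩ _) ≈⟨ Free-independent d c ⟩
      Pr (Z i₀ ⊢ C) * Pr _ ≈⟨ *-congˡ (Pr-cong (Free-event d) (D⊆D′ , D′⊆D)) ⟩
      Pr (Z i₀ ⊢ C) * Pr _ ∎

-- Walks, cycles and orientations of forests

module Graph (em : ∀ {ℓ} → ExcludedMiddle ℓ) {n m : ℕ} (G : Multigraph n m) where
  open Multigraph G

  Joins-unique : ∀ {e a b u v} → Joins e u v → Joins e a b → (a ≡ u × b ≡ v) ⊎ (a ≡ v × b ≡ u)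
  Joins-unique (inj₁ p) (inj₁ q) = inj₁ (,-injective (≡.trans (≡.sym q) p))
  Joins-unique (inj₁ p) (inj₂ q) with ≡.refl , ≡.refl ← ,-injective (≡.trans (≡.sym q) p) = inj₂ (≡.refl , ≡.refl)
  Joins-unique (inj₂ p) (inj₁ q) with ≡.refl , ≡.refl ← ,-injective (≡.trans (≡.sym q) p) = inj₂ (≡.refl , ≡.refl)
  Joins-unique (inj₂ p) (inj₂ q) with ≡.refl , ≡.refl ← ,-injective (≡.trans (≡.sym q) p) = inj₁ (≡.refl , ≡.refl)

  vertices : ∀ {u w} → Walk u w → List (Fin n)
  vertices {u} []           = u ∷ []
  vertices {u} (step _ _ p) = u ∷ vertices p

  source∈vertices : ∀ {u w} (p : Walk u w) → u ∈ vertices p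
  source∈vertices []           = here ≡.refl
  source∈vertices (step _ _ _) = here ≡.refl

  target∈vertices : ∀ {u w} (p : Walk u w) → w ∈ vertices p
  target∈vertices []           = here ≡.refl
  target∈vertices (step _ _ p) = there (target∈vertices p)

  origins⊆vertices : ∀ {u w x} (p : Walk u w) → x ∈ origins p → x ∈ vertices p
  origins⊆vertices (step _ _ p) (here x≡u) = here x≡u
  origins⊆vertices (step _ _ p) (there x∈) = there (origins⊆vertices p x∈)

  endpoint∈vertices : ∀ {u w e a b} (p : Walk u w) → e ∈ edges p → Joins e a b → a ∈ vertices p
  endpoint∈vertices (step e j p) (here ≡.refl) j′ with Joins-unique j j′
  ... | inj₁ (≡.refl , _) = here ≡.refl
  ... | inj₂ (≡.refl , _) = there (source∈vertices p)
  endpoint∈vertices (step e j p) (there e∈) j′ = there (endpoint∈vertices p e∈ j′)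

  -- All vertices are distinct, the last one included, in contrast to the condition on `origins` in
  -- a cycle. One more edge can therefore close such a path.
  data Simple : ∀ {u w} → Walk u w → Set where
    []   : ∀ {v} → Simple ([] {v})
    step : ∀ {u v w e} {j : Joins e u v} {p : Walk v w} →
           u ∉ vertices p → Simple p → Simple (step e j p)

  simple-edges : ∀ {u w} {p : Walk u w} → Simple p → Unique (edges p)
  simple-edges []                       = []
  simple-edges (step {e = e} {j} {p} u∉ s) =
    All.tabulate (λ { x∈ ≡.refl → u∉ (endpoint∈vertices p x∈ j) }) ∷ simple-edges s

  simple-origins : ∀ {u w} {p : Walk u w} → Simple p → Unique (origins p)
  simple-origins []                = []
  simple-origins (step {p = p} u∉ s) =
    All.tabulate (λ { x∈ ≡.refl → u∉ (origins⊆vertices p x∈) }) ∷ simple-origins s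

  simple-target : ∀ {u w} {p : Walk u w} → Simple p → w ∉ origins p
  simple-target (step {p = p} u∉ s) (here ≡.refl) = u∉ (target∈vertices p)
  simple-target (step u∉ s)         (there w∈)  = simple-target s w∈

  suffix : ∀ {ℓ} {P : Fin m → Set ℓ} {u v w} (p : Walk v w) → Simple p → All P (edges p) →
    u ∈ vertices p → Σ (Walk u w) λ q → Simple q × All P (edges q)
  suffix []             s          ps       (here ≡.refl) = [] , s , ps
  suffix p@(step _ _ _) s          ps       (here ≡.refl) = p , s , ps
  suffix (step _ _ p)   (step _ s) (_ ∷ ps) (there u∈)  = suffix p s ps u∈

  -- Loop erasure: if the new first vertex recurs on the simple remainder, the walk restarts from
  -- that later visit.
  erase-loops : ∀ {ℓ} {P : Fin m → Set ℓ} {u w} (p : Walk u w) → All P (edges p) →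
    Σ (Walk u w) λ q → Simple q × All P (edges q)
  erase-loops []           []         = [] , [] , []
  erase-loops {u = u} (step e j p) (pe ∷ ps) with erase-loops p ps
  ... | q , s , qs with em {P = u ∈ vertices q}
  ...   | yes u∈ = suffix q s qs u∈
  ...   | no  u∉ = step e j q , step u∉ s , pe ∷ qs

  -- The empty path covers loops. The condition `e ∉ edges p` excludes going back along the same
  -- edge but still allows a parallel one, so cycles of length two are included.
  close-cycle : ∀ {F e u v} → Joins e v u → e ∈ˢ F → (p : Walk u v) → Simple p →
    e ∉ edges p → All (_∈ˢ F) (edges p) → CycleIn F
  close-cycle {e = e} j e∈F p s e∉ p⊆F = record
    { walk             = step e j p
    ; nonEmpty         = λ ()
    ; distinctEdges    = All.tabulate (λ { x∈ ≡.refl → e∉ x∈ }) ∷ simple-edges s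
    ; distinctVertices = All.tabulate (λ { x∈ ≡.refl → simple-target s x∈ }) ∷ simple-origins s
    ; contained        = e∈F ∷ p⊆F
    }

  Connected : List (Fin m) → Fin n → Fin n → Set
  Connected L u v = Σ (Walk u v) λ p → All (_∈ L) (edges p)

  Connected-step : ∀ {L e a b v} → e ∈ L → Joins e a b → Connected L a v → Connected L b v
  Connected-step e∈L j (p , p⊆L) = step _ (Sum.swap j) p , e∈L ∷ p⊆L

  Connected-join : ∀ {L u v w} → Connected L u v → Connected L u w → Connected L v w
  Connected-join ([] , _) q = q
  Connected-join (step e j p , e∈L ∷ p⊆L) q = Connected-join (p , p⊆L) (Connected-step e∈L j q)

  Connected-edge : ∀ {L e a b x y v} → e ∈ L → Joins e a b → Joins e x y →
    Connected L a v → Connected L x v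
  Connected-edge e∈L j j′ c with Joins-unique j j′
  ... | inj₁ (≡.refl , _) = c
  ... | inj₂ (≡.refl , _) = Connected-step e∈L j c

  -- Prescribing a vertex that is nobody's child is what strengthens the induction: a new edge needs
  -- an end that is still free, and choosing that end as root frees it.
  record Orientation (L : List (Fin m)) (root : Fin n) : Set where
    field
      child     : Fin m → Fin n
      incident  : ∀ {e} → e ∈ L → ∃ λ u → Joins e (child e) u
      injective : ∀ {e e′} → e ∈ L → e′ ∈ L → child e ≡ child e′ → e ≡ e′
      avoids    : ∀ {e} → e ∈ L → child e ≢ root

  -- An end w of the new edge e that is not connected to the root becomes the
  -- child of e: the component of w is reoriented so as to avoid w.
  orientation-∷ : ∀ {e L root w w′} → e ∉ L → Joins e w w′ → ¬ Connected L root w →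
    Orientation L w → Orientation L root → Orientation (e ∷ L) root
  orientation-∷ {e} {L} {root} {w} {w′} e∉L joins ¬conn W R = record
    { child     = child
    ; incident  = incident
    ; injective = injective
    ; avoids    = avoids
    }
    where
    module W = Orientation W
    module R = Orientation R
    C : Fin n → Set
    C x = Connected L x w
    -- An edge of `L` lies within one component, so testing one of its ends decides which of the two
    -- orientations applies.
    child : Fin m → Fin n
    child x with x ≟ e | em {P = C (proj₁ (ends x))}
    ... | yes _ | _     = w
    ... | no  _ | yes _ = W.child x
    ... | no  _ | no  _ = R.child x
    child-new : child e ≡ w
    child-new with e ≟ e
    ... | yes _  = ≡.refl
    ... | no e≢e = contradiction ≡.refl e≢e
    -- It also records whether the child lies in the component of `w`, which keeps the children of
    -- the two orientations apart.
    child-old : ∀ {x} → x ∈ L → (child x ≡ W.child x × C (W.child x)) ⊎ (child x ≡ R.child x × ¬ C (R.child x))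
    child-old {x} x∈ with x ≟ e | em {P = C (proj₁ (ends x))}
    ... | yes ≡.refl | _    = contradiction x∈ e∉L
    ... | no _ | yes c = inj₁ (≡.refl , Connected-edge x∈ (inj₁ ≡.refl) (proj₂ (W.incident x∈)) c)
    ... | no _ | no ¬c = inj₂ (≡.refl , ¬c ∘ Connected-edge x∈ (proj₂ (R.incident x∈)) (inj₁ ≡.refl))
    old≢w : ∀ {x} → x ∈ L → child x ≢ w
    old≢w x∈ eq with child-old x∈
    ... | inj₁ (eq′ , _)  = W.avoids x∈ (≡.trans (≡.sym eq′) eq)
    ... | inj₂ (eq′ , ¬c) = ¬c (≡.subst C (≡.trans (≡.sym eq) eq′) ([] , []))
    incident : ∀ {x} → x ∈ e ∷ L → ∃ λ u → Joins x (child x) u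
    incident (here ≡.refl) = w′ , ≡.subst (λ y → Joins e y w′) (≡.sym child-new) joins
    incident {x} (there x∈) with child-old x∈
    ... | inj₁ (eq , _) = ≡.subst (λ y → ∃ (Joins x y)) (≡.sym eq) (W.incident x∈)
    ... | inj₂ (eq , _) = ≡.subst (λ y → ∃ (Joins x y)) (≡.sym eq) (R.incident x∈)
    injective : ∀ {x y} → x ∈ e ∷ L → y ∈ e ∷ L → child x ≡ child y → x ≡ y
    injective (here ≡.refl) (here ≡.refl) _  = ≡.refl
    injective (here ≡.refl) (there y∈)  eq = contradiction (≡.trans (≡.sym eq) child-new) (old≢w y∈)
    injective (there x∈)  (here ≡.refl) eq = contradiction (≡.trans eq child-new) (old≢w x∈)
    injective (there x∈)  (there y∈)  eq with child-old x∈ | child-old y∈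
    ... | inj₁ (p , _) | inj₁ (q , _) = W.injective x∈ y∈ (≡.trans (≡.sym p) (≡.trans eq q))
    ... | inj₂ (p , _) | inj₂ (q , _) = R.injective x∈ y∈ (≡.trans (≡.sym p) (≡.trans eq q))
    ... | inj₁ (p , c) | inj₂ (q , ¬c) = contradiction (≡.subst C (≡.trans (≡.sym p) (≡.trans eq q)) c) ¬c
    ... | inj₂ (p , ¬c) | inj₁ (q , c) = contradiction (≡.subst C (≡.trans (≡.sym q) (≡.trans (≡.sym eq) p)) c) ¬c
    avoids : ∀ {x} → x ∈ e ∷ L → child x ≢ root
    avoids (here ≡.refl) eq = ¬conn (≡.subst C (≡.trans (≡.sym child-new) eq) ([] , []))
    avoids (there x∈) eq with child-old x∈
    ... | inj₁ (p , c) = ¬conn (≡.subst C (≡.trans (≡.sym p) eq) c)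
    ... | inj₂ (p , _) = R.avoids x∈ (≡.trans (≡.sym p) eq)

  -- The ends of `e` are not connected within `L`, since a simple path between them would close to a
  -- cycle. Hence some end is not connected to the root and can be the child. The recursion is
  -- called with two different roots.
  orient : ∀ {F} → Forest F → ∀ L → Unique L → All (_∈ˢ F) L → ∀ root → Orientation L root
  orient forest [] [] [] root = record
    { child = λ _ → root ; incident = λ () ; injective = λ () ; avoids = λ () }
  orient {F} forest (e ∷ L) (e∉ ∷ unique) (e∈F ∷ L⊆F) root = extend (em {P = Connected L root u})
    where
    u v : Fin n
    u = proj₁ (ends e)
    v = proj₂ (ends e)
    e∉L : e ∉ L
    e∉L e∈L = All.lookup e∉ e∈L ≡.refl
    recurse : ∀ r → Orientation L r
    recurse = orient forest L unique L⊆F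
    separated : ¬ Connected L u v
    separated (p , p⊆L) with erase-loops p p⊆L
    ... | q , s , q⊆L = forest (close-cycle (inj₂ ≡.refl) e∈F q s
      (λ e∈q → e∉L (All.lookup q⊆L e∈q)) (All.map (All.lookup L⊆F) q⊆L))
    extend : Dec (Connected L root u) → Orientation (e ∷ L) root
    extend (no ¬conn)  = orientation-∷ e∉L (inj₁ ≡.refl) ¬conn (recurse u) (recurse root)
    extend (yes conn) = orientation-∷ e∉L (inj₂ ≡.refl)
      (λ conn′ → separated (Connected-join conn conn′)) (recurse v) (recurse root)

  no-loops : ∀ {F e v} → Forest F → e ∈ˢ F → ¬ Joins e v v
  no-loops forest e∈F j = forest (close-cycle j e∈F [] [] (λ ()) [])

  forest-children : ∀ {F} → Forest F → ∃ λ (child : Fin m → Fin n) →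
    (∀ {e} → e ∈ˢ F → ∃ λ u → Joins e (child e) u × child e ≢ u) ×
    (∀ {e e′} → e ∈ˢ F → e′ ∈ˢ F → child e ≡ child e′ → e ≡ e′)
  forest-children {F} forest with em {P = Fin n}
  -- A graph without vertices offers no root, but it has no edges either.
  ... | no empty = proj₁ ∘ ends , (λ {e} _ → ⊥-elim (empty (proj₁ (ends e)))) ,
                   (λ {e} _ → ⊥-elim (empty (proj₁ (ends e))))
  ... | yes root = child ,
    (λ e∈F → let (u , j) = incident (listed e∈F) in
      u , j , λ eq → no-loops forest e∈F (≡.subst (Joins _ _) (≡.sym eq) j)) ,
    (λ e∈F e′∈F → injective (listed e∈F) (listed e′∈F))
    where
    L : List (Fin m)
    L = List.filter (_∈? F) (allFin m)
    listed : ∀ {e} → e ∈ˢ F → e ∈ L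
    listed = ∈-filter⁺ (_∈? F) (∈-allFin _)
    open Orientation (orient forest L (Unique.filter⁺ (_∈? F) (Unique.allFin⁺ m))
      (All.tabulate (proj₂ ∘ ∈-filter⁻ (_∈? F) {xs = allFin m})) root)

  -- A walk changes sides of the cut {v} exactly when it uses e, so a closed
  -- walk cannot use e just once.
  pendant-forest : ∀ {F e u v} → Forest F → Joins e v u → v ≢ u →
    (∀ {f w} → f ∈ˢ F → ¬ Joins f v w) → Forest (F ∪ˢ ⁅ e ⁆)
  pendant-forest {F} {e} {u} {v} forest joins v≢u isolated cycle = conclude
    where
    open CycleIn cycle

    old : ∀ {x} → e ≢ x → x ∈ˢ F ∪ˢ ⁅ e ⁆ → x ∈ˢ F
    old e≢x x∈ with x∈p∪q⁻ F ⁅ e ⁆ x∈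
    ... | inj₁ x∈F = x∈F
    ... | inj₂ x∈e = contradiction (≡.sym (x∈⁅y⁆⇒x≡y e x∈e)) e≢x

    away : ∀ {x a b} → e ≢ x → x ∈ˢ F ∪ˢ ⁅ e ⁆ → Joins x a b → a ≢ v × b ≢ v
    away e≢x x∈ j = (λ { ≡.refl → isolated (old e≢x x∈) j }) , λ { ≡.refl → isolated (old e≢x x∈) (Sum.swap j) }

    stay : ∀ {a b} (p : Walk a b) → All (_∈ˢ F ∪ˢ ⁅ e ⁆) (edges p) → e ∉ edges p →
      (a ≡ v → b ≡ v) × (a ≢ v → b ≢ v)
    stay []           []        e∉ = (λ a≡v → a≡v) , (λ a≢v → a≢v)
    stay (step x j p) (x∈ ∷ p⊆) e∉ with away (e∉ ∘ here) x∈ j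
    ... | a≢v , a′≢v = (λ a≡v → contradiction a≡v a≢v) , (λ _ → proj₂ (stay p p⊆ (e∉ ∘ there)) a′≢v)

    cross : ∀ {a b} (p : Walk a b) → All (_∈ˢ F ∪ˢ ⁅ e ⁆) (edges p) → Unique (edges p) → e ∈ edges p →
      (a ≡ v → b ≢ v) × (a ≢ v → b ≡ v)
    cross (step x j p) (x∈ ∷ p⊆) (x∉ ∷ _) (here ≡.refl) with Joins-unique joins j | stay p p⊆ (λ e∈ → All.lookup x∉ e∈ ≡.refl)
    ... | inj₁ (≡.refl , ≡.refl) | _ , off = (λ _ → off (v≢u ∘ ≡.sym)) , (λ v≢v → contradiction ≡.refl v≢v)
    ... | inj₂ (≡.refl , ≡.refl) | on , _  = (λ u≡v → contradiction (≡.sym u≡v) v≢u) , (λ _ → on ≡.refl)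
    cross (step x j p) (x∈ ∷ p⊆) (x∉ ∷ unique) (there e∈) with away (λ { ≡.refl → All.lookup x∉ e∈ ≡.refl }) x∈ j
    ... | a≢v , a′≢v = (λ a≡v → contradiction a≡v a≢v) , (λ _ → proj₂ (cross p p⊆ unique e∈) a′≢v)

    conclude : ⊥
    conclude with em {P = e ∈ edges walk} | em {P = base ≡ v}
    ... | no e∉  | _ = forest (record
      { walk             = walk
      ; nonEmpty         = nonEmpty
      ; distinctEdges    = distinctEdges
      ; distinctVertices = distinctVertices
      ; contained        = All.tabulate λ x∈ → old (λ { ≡.refl → e∉ x∈ }) (All.lookup contained x∈)
      })
    ... | yes e∈ | yes b≡v = proj₁ (cross walk contained distinctEdges e∈) b≡v b≡v
    ... | yes e∈ | no  b≢v = b≢v (proj₂ (cross walk contained distinctEdges e∈) b≢v)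

-- Threshold events of a prophet instance

module RandomCut (em : ∀ {ℓ} → ExcludedMiddle ℓ) (ℝ : CompleteOrderedField) (𝒫 : ProbabilitySpace ℝ)
                 {n m : ℕ} (I : ProphetInstance ℝ 𝒫 n m) where
  open CompleteOrderedField ℝ hiding (zero)
  open ProbabilitySpace 𝒫
  open Expectation em ℝ 𝒫
  open Prophet em ℝ 𝒫 I
  open ProphetInstance I
  open OrderedField em ℝ
  open Measure em ℝ 𝒫
  open Graph em graph
  open ≤-Reasoning

  X++Y-rv : ∀ i → RandomVariable ((X VecF.++ Y) i)
  X++Y-rv i with splitAt m i
  ... | inj₁ e = X-rv e
  ... | inj₂ e = Y-rv e

  Free-X : ∀ {e₀ e P} → e ≢ e₀ → Borel P → Free X++Y-rv independent (e₀ ↑ˡ m) (X e ⊢ P)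
  Free-X {e₀} {e} {P} e≢e₀ p = ≡.subst (λ Z → Free X++Y-rv independent (e₀ ↑ˡ m) (Z ⊢ P))
    (lookup-++ˡ X Y e) (Free-coordinate X++Y-rv independent _ (e≢e₀ ∘ ↑ˡ-injective m e e₀) p)

  Free-Y : ∀ {e₀ e P} → Borel P → Free X++Y-rv independent (e₀ ↑ˡ m) (Y e ⊢ P)
  Free-Y {e₀} {e} {P} p = ≡.subst (λ Z → Free X++Y-rv independent (e₀ ↑ˡ m) (Z ⊢ P))
    (lookup-++ʳ X Y e) (Free-coordinate X++Y-rv independent _ distinct p)
    where
    distinct : m ↑ʳ e ≢ e₀ ↑ˡ m
    distinct eq with () ← ≡.trans (≡.sym (splitAt-↑ʳ m m e)) (≡.trans (≡.cong (splitAt m) eq) (splitAt-↑ˡ m e₀ m))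

  X-independent : ∀ {e D C} → Free X++Y-rv independent (e ↑ˡ m) D → Borel C →
    Pr ((X e ⊢ C) ∩ D) ≈ Pr (X e ⊢ C) * Pr D
  X-independent {e} {D} {C} d c = ≡.subst (λ Z → Pr ((Z ⊢ C) ∩ D) ≈ Pr (Z ⊢ C) * Pr D)
    (lookup-++ˡ X Y e) (Free-independent X++Y-rv independent _ d c)

  AboveThreshold-event : ∀ t r e → Event (AboveThreshold [ t ] r e)
  AboveThreshold-event t r e = Events.∪-closed (X-rv e _ (Borel-> t))
    (Events.∩-closed (X-rv e _ (Borel-≈ t)) (Y-rv e _ (Borel-≤ r)))

  -- Tie-breaking couples the value of `e` with its seed, so this event is not a box. Separating a
  -- smaller value from a lost tie gives two disjoint ones, which is why `Free` admits unions.
  Free-below : ∀ {e₀ e} t r → e ≢ e₀ →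
    Free X++Y-rv independent (e₀ ↑ˡ m) (∁ (AboveThreshold [ t ] r e))
  Free-below {e₀} {e} t r e≢e₀ = respᶠ (below , ¬above)
    (_⊎ᶠ_ (Free-X e≢e₀ (complement (ray t)))
      (Free-∩ X++Y-rv independent _ (Free-X e≢e₀ (Borel-≈ t)) (Free-Y (complement (Borel-≤ r))))
      {λ ω (t≰x , (x≈t , _)) → t≰x (≤-reflexive (sym x≈t))})
    where
    below : ((X e ⊢ ∁ (t ≤_)) ∪ ((X e ⊢ (_≈ t)) ∩ (Y e ⊢ ∁ (_≤ r)))) ⊆ ∁ (AboveThreshold [ t ] r e)
    below (inj₁ t≰x)         (inj₁ (t≤x , _))  = t≰x t≤x
    below (inj₁ t≰x)         (inj₂ (x≈t , _))  = t≰x (≤-reflexive (sym x≈t))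
    below (inj₂ (x≈t , _))   (inj₁ (_ , t≉x))  = t≉x (sym x≈t)
    below (inj₂ (_ , y≰r))   (inj₂ (_ , y≤r))  = y≰r y≤r
    ¬above : ∁ (AboveThreshold [ t ] r e) ⊆ ((X e ⊢ ∁ (t ≤_)) ∪ ((X e ⊢ (_≈ t)) ∩ (Y e ⊢ ∁ (_≤ r))))
    ¬above {ω} ¬a with em {P = t ≤ X e ω}
    ... | no t≰x = inj₁ t≰x
    ... | yes t≤x = inj₂ (x≈t , λ y≤r → ¬a (inj₂ (x≈t , y≤r)))
      where
      x≈t : X e ω ≈ t
      x≈t = antisym (≮⇒≥ (¬a ∘ inj₁)) t≤x

  X-weight : ∀ F e ω → (if does (e ∈? F) then X e ω else 0#) ≡ when (e ∈ˢ F) (X e ω)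
  X-weight F e ω with e ∈? F
  ... | yes e∈F = ≡.sym (when-true e∈F _)
  ... | no  e∉F = ≡.sym (when-false e∉F _)

  Forest-∅ : Forest ∅ˢ
  Forest-∅ record { walk = [] ; nonEmpty = nonEmpty } = nonEmpty ≡.refl
  Forest-∅ record { walk = step _ _ _ ; contained = e∈∅ ∷ _ } = ∉⊥ e∈∅

  -- The algorithm for a fixed vertex set

  module Cut (A : Subset n) (t : Fin n → Carrier) (q : Fin m → Carrier) where

    CutEdge : Fin n → Fin m → Set
    CutEdge v e = v ∉ˢ A × ∃[ u ] (Joins e v u × u ∈ˢ A)

    CutEdge-unique : ∀ {v v′ e} → CutEdge v e → CutEdge v′ e → v ≡ v′
    CutEdge-unique (v∉A , u , j , u∈A) (v′∉A , u′ , j′ , u′∈A) with Joins-unique j j′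
    ... | inj₁ (v′≡v , _) = ≡.sym v′≡v
    ... | inj₂ (v′≡u , _) = contradiction (≡.subst (_∈ˢ A) (≡.sym v′≡u) u∈A) v′∉A

    Above : Fin n → Fin m → Pred Ω 0ℓ
    Above v e = AboveThreshold [ t v ] (q e) e

    Accepts : Fin m → Pred Ω 0ℓ
    Accepts e = AboveThreshold (edgeThreshold A t e) (q e) e

    -- Only edges strictly before `e` are mentioned, which makes this event independent of `X e`;
    -- `First` is not.
    NoneBefore : Fin n → Fin m → Pred Ω 0ℓ
    NoneBefore v e ω = ∀ f → f Fin.< e × CutEdge v f → ¬ Above v f ω

    First : Fin n → Fin m → Pred Ω 0ℓ
    First v e = Above v e ∩ NoneBefore v e

    None : Fin n → Pred Ω 0ℓ
    None v ω = ∀ f → CutEdge v f → ¬ Above v f ω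

    Some : Fin n → Pred Ω 0ℓ
    Some v = SomeAbove A (t v) q v

    edgeThreshold-cut : ∀ {v e} → CutEdge v e → edgeThreshold A t e ≡ [ t v ]
    edgeThreshold-cut {v} {e} (v∉A , u , j , u∈A) with ends e
    edgeThreshold-cut {v} {e} (v∉A , u , inj₁ ≡.refl , u∈A) | _ with v ∈? A | u ∈? A
    ... | no  _   | yes _   = ≡.refl
    ... | yes v∈A | _       = contradiction v∈A v∉A
    ... | no  _   | no u∉A  = contradiction u∈A u∉A
    edgeThreshold-cut {v} {e} (v∉A , u , inj₂ ≡.refl , u∈A) | _ with u ∈? A | v ∈? A
    ... | yes _   | no _    = ≡.refl
    ... | _       | yes v∈A = contradiction v∈A v∉A
    ... | no u∉A  | no _    = contradiction u∈A u∉A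

    edgeThreshold-uncut : ∀ {v w e} → v ∉ˢ A → w ∉ˢ A → Joins e v w → edgeThreshold A t e ≡ ⊤⁺
    edgeThreshold-uncut {v} {w} {e} v∉A w∉A j with ends e
    edgeThreshold-uncut {v} {w} {e} v∉A w∉A (inj₁ ≡.refl) | _ with v ∈? A | w ∈? A
    ... | no  _   | no _    = ≡.refl
    ... | yes v∈A | _       = contradiction v∈A v∉A
    ... | no _    | yes w∈A = contradiction w∈A w∉A
    edgeThreshold-uncut {v} {w} {e} v∉A w∉A (inj₂ ≡.refl) | _ with w ∈? A | v ∈? A
    ... | no  _   | no _    = ≡.refl
    ... | _       | yes v∈A = contradiction v∈A v∉A
    ... | yes w∈A | no _    = contradiction w∈A w∉A

    Accepts⇒Above : ∀ {v e ω} → CutEdge v e → Accepts e ω → Above v e ω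
    Accepts⇒Above {v} {e} {ω} cut = ≡.subst (λ T → AboveThreshold T (q e) e ω) (edgeThreshold-cut cut)

    Above⇒Accepts : ∀ {v e ω} → CutEdge v e → Above v e ω → Accepts e ω
    Above⇒Accepts {v} {e} {ω} cut = ≡.subst (λ T → AboveThreshold T (q e) e ω) (≡.sym (edgeThreshold-cut cut))

    -- Edges between two vertices outside `A` have an infinite threshold, so a vertex outside `A`
    -- can acquire only cut edges and stays isolated until one of them exceeds its threshold.
    Accepts⇒CutEdge : ∀ {v w e ω} → v ∉ˢ A → Joins e v w → Accepts e ω → CutEdge v e
    Accepts⇒CutEdge {v} {w} {e} {ω} v∉A j accepts with w ∈? A
    ... | yes w∈A = v∉A , w , j , w∈A
    ... | no  w∉A = ⊥-elim (≡.subst (λ T → AboveThreshold T (q e) e ω) (edgeThreshold-uncut v∉A w∉A j) accepts)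

    open NonAdaptive (edgeThreshold A t) q

    arrive-⊇ : ∀ {ω F e f} → f ∈ˢ F → f ∈ˢ arrive ω F e
    arrive-⊇ {ω} {F} {e} f∈F with em {P = Accepts e ω × Forest (F ∪ˢ ⁅ e ⁆)}
    ... | yes _ = x∈p∪q⁺ (inj₁ f∈F)
    ... | no  _ = f∈F

    foldl-⊇ : ∀ {ω F f} L → f ∈ˢ F → f ∈ˢ List.foldl (arrive ω) F L
    foldl-⊇ []      f∈F = f∈F
    foldl-⊇ (e ∷ L) f∈F = foldl-⊇ L (arrive-⊇ f∈F)

    -- When the first cut edge at v above its threshold arrives, v is still
    -- isolated in the accepted forest.
    first-accepted-from : ∀ {ω v e} → CutEdge v e → First v e ω → ∀ L F → AllPairs Fin._<_ L → Forest F →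
      (∀ {f} → f ∈ˢ F → Accepts f ω × All (f Fin.<_) L) → e ∈ L → e ∈ˢ List.foldl (arrive ω) F L
    first-accepted-from {ω} {v} {e} cut@(v∉A , u , j , u∈A) (above , none) (e ∷ L) F sorted forest F-ok (here ≡.refl) =
      foldl-⊇ L accepted-now
      where
      acceptable : Accepts e ω × Forest (F ∪ˢ ⁅ e ⁆)
      acceptable = Above⇒Accepts cut above , pendant-forest forest j
        (λ v≡u → v∉A (≡.subst (_∈ˢ A) (≡.sym v≡u) u∈A))
        -- An already accepted edge at `v` would be an earlier cut edge above the threshold.
        (λ f∈F j′ → let (accepts , f<) = F-ok f∈F
                        cut′ = Accepts⇒CutEdge v∉A j′ accepts in
          none _ (All.head f< , cut′) (Accepts⇒Above cut′ accepts))
      accepted-now : e ∈ˢ arrive ω F e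
      accepted-now with em {P = Accepts e ω × Forest (F ∪ˢ ⁅ e ⁆)}
      ... | yes _  = x∈p∪q⁺ (inj₂ (x∈⁅x⁆ e))
      ... | no ¬ok = contradiction acceptable ¬ok
    first-accepted-from {ω} cut first (x ∷ L) F (x< ∷ sorted) forest F-ok (there e∈L)
      with em {P = Accepts x ω × Forest (F ∪ˢ ⁅ x ⁆)}
    ... | no _ = first-accepted-from cut first L F sorted forest (λ f∈F → proj₁ (F-ok f∈F) , All.tail (proj₂ (F-ok f∈F))) e∈L
    ... | yes (accepts , forest′) = first-accepted-from cut first L (F ∪ˢ ⁅ x ⁆) sorted forest′ F′-ok e∈L
      where
      F′-ok : ∀ {f} → f ∈ˢ F ∪ˢ ⁅ x ⁆ → Accepts f ω × All (f Fin.<_) L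
      F′-ok f∈ with x∈p∪q⁻ F ⁅ x ⁆ f∈
      ... | inj₁ f∈F = proj₁ (F-ok f∈F) , All.tail (proj₂ (F-ok f∈F))
      ... | inj₂ f∈x with ≡.refl ← x∈⁅y⁆⇒x≡y x f∈x = accepts , x<

    first-accepted : ∀ {ω v e} → CutEdge v e → First v e ω → e ∈ˢ accepted ω
    first-accepted cut first = first-accepted-from cut first (allFin m) ∅ˢ
      (AllPairs.tabulate⁺-< id) Forest-∅ (λ f∈∅ → contradiction f∈∅ ∉⊥) (∈-allFin _)

    Above-event : ∀ v e → Event (Above v e)
    Above-event v e = AboveThreshold-event (t v) (q e) e

    NoneBefore-event : ∀ v e → Event (NoneBefore v e)
    NoneBefore-event v e = Events.⋂-closed Event-U λ f → Events.⇒-closed (Event-∁ (Above-event v f))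

    First-event : ∀ v e → Event (First v e)
    First-event v e = Events.∩-closed (Above-event v e) (NoneBefore-event v e)

    None-event : ∀ v → Event (None v)
    None-event v = Events.⋂-closed Event-U λ f → Events.⇒-closed (Event-∁ (Above-event v f))

    Free-NoneBefore : ∀ v e → Free X++Y-rv independent (e ↑ˡ m) (NoneBefore v e)
    Free-NoneBefore v e = Free-⋂ X++Y-rv independent _ factor
      where
      factor : ∀ f → Free X++Y-rv independent (e ↑ˡ m) (λ ω → f Fin.< e × CutEdge v f → ¬ Above v f ω)
      factor f with em {P = f Fin.< e × CutEdge v f}
      ... | yes p@(f<e , _) = respᶠ ((λ x _ → x) , λ g → g p)
                                (Free-below (t v) (q f) (λ { ≡.refl → <-irrefl ≡.refl f<e }))
      ... | no ¬p = respᶠ ((λ _ p → contradiction p ¬p) , _) (Free-U X++Y-rv independent _)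

    first-exists : ∀ {v ω e} → CutEdge v e → Above v e ω → ∃ λ f → CutEdge v f × First v f ω
    first-exists {v} {ω} {e} = search (<-wellFounded e)
      where
      search : ∀ {e} → Acc Fin._<_ e → CutEdge v e → Above v e ω → ∃ λ f → CutEdge v f × First v f ω
      search {e} (acc rec) cut above with em {P = ∃ λ f → f Fin.< e × CutEdge v f × Above v f ω}
      ... | yes (f , f<e , cut′ , above′) = search (rec f<e) cut′ above′
      ... | no ¬earlier = e , cut , above , λ f (f<e , cut′) above′ → ¬earlier (f , f<e , cut′ , above′)

    -- These are the vertices whose threshold the median condition determines. Elsewhere `t v` is
    -- arbitrary, possibly negative, so estimates involving it are guarded by this predicate.
    Active : Fin n → Set
    Active v = ∃ (CutEdge v)

    -- Consequences of the median condition

    module Thresholds (median : MedianThresholds A t q) where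

      Pr-Some : ∀ {v} → Active v → Pr (Some v) ≈ ½
      Pr-Some (e , v∉A , u , j , u∈A) = median _ v∉A (e , u , j , u∈A)

      None≐∁Some : ∀ {v} → Active v → None v ≐ ∁ (Some v)
      None≐∁Some (_ , v∉A , _) =
        (λ none (e , u , j , u∈A , above) → none e (v∉A , u , j , u∈A) above) ,
        (λ ¬some e (_ , u , j , u∈A) above → ¬some (e , u , j , u∈A , above))

      Some-event : ∀ {v} → Active v → Event (Some v)
      Some-event active = Event-resp
        ((λ ¬none → decidable-stable em (¬none ∘ proj₂ (None≐∁Some active))) , λ some none → proj₁ (None≐∁Some active) none some)
        (Event-∁ (None-event _))

      -- The event contains `None v`, the complement of an event of probability ½, so the bound is
      -- uniform in `e`.
      ½≤Pr-NoneBefore : ∀ {v e} → Active v → ½ ≤ Pr (NoneBefore v e)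
      ½≤Pr-NoneBefore {v} {e} active = ≤-trans (+-cancelˡ-≤ ½ (≤-reflexive (begin-equality
        ½ + ½                   ≈⟨ +-cong (*-identityʳ ½) (*-identityʳ ½) ⟨
        ½ * 1# + ½ * 1#         ≈⟨ ½x+½x≈x 1# ⟩
        1#                      ≈⟨ Pr-∁ (Some-event active) ⟨
        Pr (Some v) + Pr (∁ (Some v)) ≈⟨ +-cong (Pr-Some active) (Pr-cong (Event-∁ (Some-event active))
                                           (proj₂ (None≐∁Some active) , proj₁ (None≐∁Some active))) ⟩
        ½ + Pr (None v) ∎)))
        (Pr-mono (None-event v) (NoneBefore-event v e) (λ none f (_ , cut) → none f cut))

      -- A negative threshold would be exceeded surely, not with probability ½.
      threshold-nonNeg : ∀ {v} → Active v → 0# ≤ t v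
      threshold-nonNeg {v} active@(e , _ , u , j , u∈A) with em {P = 0# ≤ t v}
      ... | yes 0≤t = 0≤t
      ... | no  0≰t = contradiction (antisym 0≤1 (x+x≤x⇒x≤0 (≤-reflexive (begin-equality
        1# + 1#         ≈⟨ +-cong 1≈½ 1≈½ ⟩
        ½ + ½           ≈⟨ +-cong (*-identityʳ ½) (*-identityʳ ½) ⟨
        ½ * 1# + ½ * 1# ≈⟨ ½x+½x≈x 1# ⟩
        1#              ∎)))) 0≉1
        where
        t<X : ∀ ω → t v < X e ω
        t<X ω = <-≤-trans (≰⇒≥ 0≰t , λ t≈0 → 0≰t (≤-reflexive (sym t≈0))) (X-nonNeg e ω)
        1≈½ : 1# ≈ ½
        1≈½ = begin-equality
          1#          ≈⟨ Pr-U ⟨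
          Pr U        ≈⟨ Pr-cong Event-U ((λ {ω} _ → e , u , j , u∈A , inj₁ (t<X ω)) , _) ⟩
          Pr (Some v) ≈⟨ Pr-Some active ⟩
          ½           ∎

      -- Whenever some edge is above the threshold, there is a first such edge. Integrating this
      -- inequality between indicators gives the bound.
      ½≤∑Pr-First : ∀ {v} → Active v → ½ ≤ sum (λ e → when (CutEdge v e) (Pr (First v e)))
      ½≤∑Pr-First {v} active = ≤-respˡ-≈ (Pr-Some active) (integral-mono
        (integral-𝟙 (Some-event active))
        (integral-sum λ e → integral-when {CutEdge v e} λ _ → integral-𝟙 (First-event v e))
        pointwise)
        where
        pointwise : ∀ ω → 𝟙 (Some v ω) ≤ sum (λ e → when (CutEdge v e) (𝟙 (First v e ω)))
        pointwise ω = when-elim (_≤ sum (λ e → when (CutEdge v e) (𝟙 (First v e ω)))) someFirst (λ _ → sum-nonNeg nonNeg)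
          where
          nonNeg : ∀ e → 0# ≤ when (CutEdge v e) (𝟙 (First v e ω))
          nonNeg e = when-nonNeg λ _ → when-nonNeg λ _ → 0≤1
          someFirst : Some v ω → 1# ≤ sum (λ e → when (CutEdge v e) (𝟙 (First v e ω)))
          someFirst (e , u , j , u∈A , above) with first-exists (proj₁ (proj₂ active) , u , j , u∈A) above
          ... | f , cut , first = begin
            1#                                    ≈⟨ reflexive (when-true first 1#) ⟨
            𝟙 (First v f ω)                       ≈⟨ reflexive (when-true cut _) ⟨
            when (CutEdge v f) (𝟙 (First v f ω))  ≤⟨ term≤sum nonNeg f ⟩
            sum (λ e → when (CutEdge v e) (𝟙 (First v e ω))) ∎

      -- Step functions below ALG and above the cut values

      module Discretization (δ : Carrier) (0<δ : 0# < δ) (N : ℕ) where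
        0≤δ : 0# ≤ δ
        0≤δ = proj₁ 0<δ
        open Staircase δ 0≤δ

        -- The expectation of `stair k s (X e)` as `δ` times a sum of tail probabilities, a discrete
        -- layer-cake formula.
        stairMean : ℕ → Carrier → Fin m → Carrier
        stairMean zero    s e = 0#
        stairMean (suc k) s e = δ * Pr (X e ⊢ (s + δ ≤_)) + stairMean k (s + δ) e

        stairMean-nonNeg : ∀ k s e → 0# ≤ stairMean k s e
        stairMean-nonNeg zero    s e = ≤-refl
        stairMean-nonNeg (suc k) s e =
          +-nonNeg (*-nonNeg 0≤δ (Pr-nonNeg (X-rv e _ (ray (s + δ))))) (stairMean-nonNeg k (s + δ) e)

        integral-stair : ∀ k s e → HasIntegral (λ ω → stair k s (X e ω)) (stairMean k s e)
        integral-stair zero    s e = integral-0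
        integral-stair (suc k) s e = integral-+
          (integral-* 0≤δ (integral-𝟙 (X-rv e _ (ray (s + δ))))) (integral-stair k (s + δ) e)

        -- Independence is applied to one ray at a time, so the expectation of the product factors
        -- level by level.
        integral-stair-𝟙 : ∀ k s {e D} → Free X++Y-rv independent (e ↑ˡ m) D →
          HasIntegral (λ ω → stair k s (X e ω) * 𝟙 (D ω)) (stairMean k s e * Pr D)
        integral-stair-𝟙 zero s d = integral-resp (λ _ → sym (zeroˡ _)) (sym (zeroˡ _)) integral-0
        integral-stair-𝟙 (suc k) s {e} {D} d = integral-resp
          (λ ω → trans (+-congʳ (trans (*-congˡ (sym 𝟙-∩)) (sym (*-assoc δ _ _)))) (sym (distribʳ _ _ _)))
          (trans (+-congʳ (trans (*-congˡ (X-independent d (ray (s + δ)))) (sym (*-assoc δ _ _)))) (sym (distribʳ _ _ _)))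
          (integral-+
            (integral-* 0≤δ (integral-𝟙 (Events.∩-closed (X-rv e _ (ray (s + δ))) (Free-event X++Y-rv independent _ d))))
            (integral-stair-𝟙 k (s + δ) d))

        -- In the second summand `NoneBefore` stands for `First`: the staircase vanishes unless
        -- `X e` exceeds the threshold, so the product is the same, but now its two factors are
        -- independent.
        gain : Fin n → Fin m → Ω → Carrier
        gain v e ω = t v * 𝟙 (First v e ω) + stair N (t v) (X e ω) * 𝟙 (NoneBefore v e ω)

        gainMean : Fin n → Fin m → Carrier
        gainMean v e = t v * Pr (First v e) + stairMean N (t v) e * Pr (NoneBefore v e)

        lower : Ω → Carrier
        lower ω = sum λ v → sum λ e → when (CutEdge v e) (gain v e ω)

        lowerMean : Carrier
        lowerMean = sum λ v → sum λ e → when (CutEdge v e) (gainMean v e)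

        vertexBound : Fin n → Ω → Carrier
        vertexBound v ω = when (Active v) (t v + δ + sum λ e → when (CutEdge v e) (stair N (t v) (X e ω)))

        upper : Ω → Carrier
        upper ω = sum λ v → vertexBound v ω

        upperMean : Carrier
        upperMean = sum λ v → when (Active v) (t v + δ + sum λ e → when (CutEdge v e) (stairMean N (t v) e))

        integral-lower : HasIntegral lower lowerMean
        integral-lower = integral-sum λ v → integral-sum λ e → integral-when {CutEdge v e} λ cut →
          integral-+ (integral-* (threshold-nonNeg (e , cut)) (integral-𝟙 (First-event v e)))
                     (integral-stair-𝟙 N (t v) (Free-NoneBefore v e))

        integral-upper : HasIntegral upper upperMean
        integral-upper = integral-sum λ v → integral-when {Active v} λ active →
          integral-+ (integral-const (+-nonNeg (threshold-nonNeg active) 0≤δ))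
                     (integral-sum λ e → integral-when {CutEdge v e} λ _ → integral-stair N (t v) e)

        gain≤ : ∀ {v e ω} → CutEdge v e → gain v e ω ≤ when (e ∈ˢ accepted ω) (X e ω)
        gain≤ {v} {e} {ω} cut = byCases (em {P = First v e ω})
          where
          s b : Carrier
          s = stair N (t v) (X e ω)
          b = when (e ∈ˢ accepted ω) (X e ω)
          t≤X : Above v e ω → t v ≤ X e ω
          t≤X (inj₁ (t≤x , _)) = t≤x
          t≤X (inj₂ (x≈t , _)) = ≤-reflexive (sym x≈t)
          -- Since `δ` is strictly positive, reaching the first step means exceeding the threshold
          -- whatever the seed; a lost tie earns nothing.
          t+δ≰X : ¬ Above v e ω → ¬ t v + δ ≤ X e ω
          t+δ≰X ¬above t+δ≤x = ¬above (inj₁ (<-≤-trans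
            (x≤x+y 0≤δ , λ t≈ → proj₂ 0<δ (antisym 0≤δ (+-cancelˡ-≤ (t v) (≤-reflexive (trans (sym t≈) (sym (+-identityʳ _)))))))
            t+δ≤x))
          stair*𝟙≈0 : ¬ First v e ω → Dec (NoneBefore v e ω) → s * 𝟙 (NoneBefore v e ω) ≈ 0#
          stair*𝟙≈0 ¬first (yes none) = trans (*-congʳ (stair≈0 N (t+δ≰X (λ above → ¬first (above , none))))) (zeroˡ _)
          stair*𝟙≈0 ¬first (no ¬none) = trans (*-congˡ (reflexive (when-false ¬none 1#))) (zeroʳ s)
          byCases : Dec (First v e ω) → gain v e ω ≤ b
          byCases (yes first) = begin
            t v * 𝟙 (First v e ω) + s * 𝟙 (NoneBefore v e ω)
              ≈⟨ +-cong (trans (*-congˡ (reflexive (when-true first 1#))) (*-identityʳ _))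
                        (trans (*-congˡ (reflexive (when-true (proj₂ first) 1#))) (*-identityʳ _)) ⟩
            t v + s ≤⟨ t+stair≤x N (t≤X (proj₁ first)) ⟩
            X e ω   ≈⟨ reflexive (when-true (first-accepted cut first) _) ⟨
            b ∎
          byCases (no ¬first) = begin
            t v * 𝟙 (First v e ω) + s * 𝟙 (NoneBefore v e ω)
              ≈⟨ +-cong (trans (*-congˡ (reflexive (when-false ¬first 1#))) (zeroʳ _)) (stair*𝟙≈0 ¬first em) ⟩
            0# + 0# ≈⟨ +-identityˡ 0# ⟩
            0#      ≤⟨ when-nonNeg (λ _ → X-nonNeg e ω) ⟩
            b       ∎

        lower≤alg : ∀ ω → lower ω ≤ alg ω
        lower≤alg ω = begin
          lower ω ≈⟨ ∑-comm (λ v e → when (CutEdge v e) (gain v e ω)) ⟩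
          sum (λ e → sum λ v → when (CutEdge v e) (gain v e ω))
            -- A cut edge has only one end outside `A`, so at most one `v` contributes for each
            -- edge.
            ≤⟨ sum-mono (λ e → ≤-respʳ-≈ (sym (reflexive (X-weight (accepted ω) e ω)))
                 (sum-when-unique {P = λ v → CutEdge v e} CutEdge-unique (λ v → gain≤) (when-nonNeg λ _ → X-nonNeg e ω))) ⟩
          alg ω ∎

        upperMean≤ : upperMean ≤ (lowerMean + lowerMean) + fromℕ n * δ
        upperMean≤ = begin
          upperMean ≤⟨ sum-mono perVertex ⟩
          sum (λ v → (row v + row v) + δ) ≈⟨ ∑-distrib-+ (λ v → row v + row v) (λ _ → δ) ⟩
          sum (λ v → row v + row v) + sum {n} (λ _ → δ)
            ≤⟨ +-mono-≤ (≤-reflexive (∑-distrib-+ row row)) (sum≤bound {n} λ _ → ≤-refl) ⟩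
          (lowerMean + lowerMean) + n · δ ≈⟨ +-congˡ (·≈fromℕ* n δ) ⟩
          (lowerMean + lowerMean) + fromℕ n * δ ∎
          where
          row S : Fin n → Carrier
          row v = sum λ e → when (CutEdge v e) (gainMean v e)
          S v = sum λ e → when (CutEdge v e) (stairMean N (t v) e)
          row-nonNeg : ∀ v → 0# ≤ row v
          row-nonNeg v = sum-nonNeg λ e → when-nonNeg λ cut → +-nonNeg
            (*-nonNeg (threshold-nonNeg (e , cut)) (Pr-nonNeg (First-event v e)))
            (*-nonNeg (stairMean-nonNeg N (t v) e) (Pr-nonNeg (NoneBefore-event v e)))
          -- Both parts of the gain lose at most a half: `t v` is collected with total probability
          -- at least ½ over the possible first edges, and each staircase keeps a factor of at least
          -- ½ from `NoneBefore`.
          half : ∀ {v} → Active v → ½ * (t v + S v) ≤ row v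
          half {v} active = begin
            ½ * (t v + S v) ≈⟨ trans (distribˡ ½ _ _) (+-congʳ (*-comm ½ (t v))) ⟩
            t v * ½ + ½ * S v
              ≤⟨ +-monoˡ-≤ _ (*-monoˡ-≤ (threshold-nonNeg active) (½≤∑Pr-First active)) ⟩
            t v * sum (λ e → when (CutEdge v e) (Pr (First v e))) + ½ * S v
              ≈⟨ +-cong (*-distribˡ-sum {m} (t v) _) (*-distribˡ-sum {m} ½ _) ⟩
            sum (λ e → t v * when (CutEdge v e) (Pr (First v e))) +
            sum (λ e → ½ * when (CutEdge v e) (stairMean N (t v) e))
              ≈⟨ ∑-distrib-+ {m} _ _ ⟨
            sum (λ e → t v * when (CutEdge v e) (Pr (First v e)) + ½ * when (CutEdge v e) (stairMean N (t v) e))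
              ≤⟨ sum-mono perEdge ⟩
            row v ∎
            where
            perEdge : ∀ e → t v * when (CutEdge v e) (Pr (First v e)) + ½ * when (CutEdge v e) (stairMean N (t v) e)
              ≤ when (CutEdge v e) (gainMean v e)
            perEdge e with em {P = CutEdge v e}
            ... | no _ = ≤-reflexive (trans (+-cong (zeroʳ _) (zeroʳ _)) (+-identityˡ 0#))
            ... | yes _ = +-monoʳ-≤ _ (≤-respˡ-≈ (*-comm _ ½)
                    (*-monoˡ-≤ (stairMean-nonNeg N (t v) e) (½≤Pr-NoneBefore active)))
          perVertex : ∀ v → when (Active v) (t v + δ + S v) ≤ (row v + row v) + δ
          perVertex v = when-elim (_≤ (row v + row v) + δ) active
            (λ _ → +-nonNeg (+-nonNeg (row-nonNeg v) (row-nonNeg v)) 0≤δ)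
            where
            active : Active v → t v + δ + S v ≤ (row v + row v) + δ
            active act = begin
              t v + δ + S v ≈⟨ solve 3 (λ t d s → t :+ d :+ s := (t :+ s) :+ d) refl (t v) δ (S v) ⟩
              (t v + S v) + δ ≈⟨ +-congʳ (½x+½x≈x (t v + S v)) ⟨
              (½ * (t v + S v) + ½ * (t v + S v)) + δ ≤⟨ +-monoˡ-≤ δ (+-mono-≤ (half act) (half act)) ⟩
              (row v + row v) + δ ∎

        stairs-nonNeg : ∀ v ω → 0# ≤ sum λ e → when (CutEdge v e) (stair N (t v) (X e ω))
        stairs-nonNeg v ω = sum-nonNeg λ e → when-nonNeg λ _ → stair-nonNeg N (t v) (X e ω)

        vertexBound-nonNeg : ∀ v ω → 0# ≤ vertexBound v ω
        vertexBound-nonNeg v ω = when-nonNeg λ active →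
          +-nonNeg (+-nonNeg (threshold-nonNeg active) 0≤δ) (stairs-nonNeg v ω)

        ≤vertexBound : ∀ {v e ω z} → CutEdge v e → z ≤ X e ω → z ≤ N · δ → z ≤ vertexBound v ω
        ≤vertexBound {v} {e} {ω} {z} cut z≤x z≤Nδ = begin
          -- A nonnegative threshold puts the top of the staircase at `N · δ` or higher, hence not
          -- below `z`.
          z ≤⟨ z≤t+δ+stair N z≤x (≤-trans z≤Nδ (x≤y+x (threshold-nonNeg (e , cut)))) ⟩
          t v + δ + stair N (t v) (X e ω) ≈⟨ +-congˡ (reflexive (when-true cut _)) ⟨
          t v + δ + when (CutEdge v e) (stair N (t v) (X e ω))
            ≤⟨ +-monoʳ-≤ _ (term≤sum (λ f → when-nonNeg {CutEdge v f} λ _ → stair-nonNeg N (t v) (X f ω)) e) ⟩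
          t v + δ + sum (λ f → when (CutEdge v f) (stair N (t v) (X f ω)))
            ≈⟨ reflexive (when-true (e , cut) _) ⟨
          vertexBound v ω ∎

        -- Each vertex is charged at most once because child is injective on F.
        cut-edges≤upper : ∀ {F ω} {z : Fin m → Carrier} (child : Fin m → Fin n) →
          (∀ {e f} → e ∈ˢ F → f ∈ˢ F → child e ≡ child f → e ≡ f) →
          (∀ e → 0# ≤ z e) → (∀ {e} → e ∈ˢ F → z e ≤ X e ω) → (∀ e → z e ≤ N · δ) →
          sum (λ e → when (e ∈ˢ F × CutEdge (child e) e) (z e)) ≤ upper ω
        cut-edges≤upper {F} {ω} {z} child injective 0≤z z≤x z≤Nδ = begin
          sum (λ e → when (P e) (z e)) ≤⟨ sum-mono spread ⟩
          sum (λ e → sum λ v → when (P e × child e ≡ v) (z e)) ≈⟨ ∑-comm (λ e v → when (P e × child e ≡ v) (z e)) ⟩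
          sum (λ v → sum λ e → when (P e × child e ≡ v) (z e)) ≤⟨ sum-mono charge ⟩
          upper ω ∎
          where
          P : Fin m → Set
          P e = e ∈ˢ F × CutEdge (child e) e
          spread : ∀ e → when (P e) (z e) ≤ sum λ v → when (P e × child e ≡ v) (z e)
          spread e = when-elim (_≤ sum λ v → when (P e × child e ≡ v) (z e))
            (λ p → ≤-respˡ-≈ (reflexive (when-true (p , ≡.refl) _)) (term≤sum {f = λ v → when (P e × child e ≡ v) (z e)} nonNeg (child e)))
            (λ _ → sum-nonNeg nonNeg)
            where
            nonNeg : ∀ v → 0# ≤ when (P e × child e ≡ v) (z e)
            nonNeg v = when-nonNeg λ _ → 0≤z e
          charge : ∀ v → sum (λ e → when (P e × child e ≡ v) (z e)) ≤ vertexBound v ω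
          charge v = sum-when-unique {P = λ e → P e × child e ≡ v}
            (λ ((e∈F , _) , p) ((f∈F , _) , q) → injective e∈F f∈F (≡.trans p (≡.sym q)))
            (λ { e ((e∈F , cut) , ≡.refl) → ≤vertexBound cut (z≤x e∈F) (z≤Nδ e) })
            (vertexBound-nonNeg v ω)

        upper-nonNeg : ∀ ω → 0# ≤ upper ω
        upper-nonNeg ω = sum-nonNeg λ v → vertexBound-nonNeg v ω

  -- Averaging over the random cut and passing to the limit

  module Competitive (T : Subset n → Fin n → Carrier) (q : Subset n → Fin m → Carrier)
                     (median : ∀ A → MedianThresholds A (T A) (q A)) where

    module Approximation (δ : Carrier) (0<δ : 0# < δ) (N : ℕ) where
      module D (A : Subset n) = Cut.Thresholds.Discretization A (T A) (q A) (median A) δ 0<δ N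

      -- The average over `A` is taken pointwise in `ω`; the factor 4 undoes the probability 1/4
      -- with which a forest edge is cut in its orientation.
      bound : Ω → Carrier
      bound ω = fromℕ 4 * average n (λ A → D.upper A ω)

      bound-nonNeg : ∀ ω → 0# ≤ bound ω
      bound-nonNeg ω = *-nonNeg (fromℕ-nonNeg 4)
        (≤-respˡ-≈ (average-const n 0#) (average-mono n λ A → D.upper-nonNeg A ω))

      -- A forest edge is cut with its child outside A with probability 1/4.
      forest≤bound : ∀ {F ω s K} → Forest F → 0# ≤ K → K ≤ N · δ → s ≤ K → s ≤ weight F ω → s ≤ bound ω
      forest≤bound {F} {ω} {s} {K} forest 0≤K K≤Nδ s≤K s≤w = begin
        s ≤⟨ truncated-sum {f = x} 0≤x 0≤K s≤K s≤w ⟩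
        sum z ≤⟨ sum-mono quarter ⟩
        sum (λ e → fromℕ 4 * average n (λ A → when (P A e) (z e)))
          ≈⟨ *-distribˡ-sum {m} (fromℕ 4) _ ⟨
        fromℕ 4 * sum (λ e → average n (λ A → when (P A e) (z e)))
          ≈⟨ *-congˡ (average-sum n λ A e → when (P A e) (z e)) ⟨
        fromℕ 4 * average n (λ A → sum λ e → when (P A e) (z e))
          ≤⟨ *-monoˡ-≤ (fromℕ-nonNeg 4) (average-mono n λ A →
               D.cut-edges≤upper A child injective 0≤z z≤X λ e → ≤-trans (x⊓y≤y (x e) K) K≤Nδ) ⟩
        bound ω ∎
        where
        orientation = forest-children forest
        child : Fin m → Fin n
        child = proj₁ orientation
        injective : ∀ {e f} → e ∈ˢ F → f ∈ˢ F → child e ≡ child f → e ≡ f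
        injective = proj₂ (proj₂ orientation)
        x z : Fin m → Carrier
        x e = if does (e ∈? F) then X e ω else 0#
        z e = x e ⊓ K
        0≤x : ∀ e → 0# ≤ x e
        0≤x e = ≤-respʳ-≈ (sym (reflexive (X-weight F e ω))) (when-nonNeg λ _ → X-nonNeg e ω)
        0≤z : ∀ e → 0# ≤ z e
        0≤z e = ⊓-nonNeg (0≤x e) 0≤K
        z≤X : ∀ {e} → e ∈ˢ F → z e ≤ X e ω
        z≤X {e} e∈F = ≤-respʳ-≈ (reflexive (≡.trans (X-weight F e ω) (when-true e∈F _))) (x⊓y≤x (x e) K)
        P : Subset n → Fin m → Set
        P A e = e ∈ˢ F × Cut.CutEdge A (T A) (q A) (child e) e
        quarter : ∀ e → z e ≤ fromℕ 4 * average n (λ A → when (P A e) (z e))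
        quarter e = byCases (em {P = e ∈ˢ F})
          where
          byCases : Dec (e ∈ˢ F) → z e ≤ fromℕ 4 * average n (λ A → when (P A e) (z e))
          byCases (no e∉F) = begin
            z e ≤⟨ x⊓y≤x (x e) K ⟩
            x e ≈⟨ reflexive (≡.trans (X-weight F e ω) (when-false e∉F _)) ⟩
            0# ≤⟨ *-nonNeg (fromℕ-nonNeg 4) (≤-respˡ-≈ (average-const n 0#)
                    (average-mono n λ A → when-nonNeg {P A e} λ _ → 0≤z e)) ⟩
            fromℕ 4 * average n (λ A → when (P A e) (z e)) ∎
          byCases (yes e∈F) with proj₁ (proj₂ orientation) e∈F
          ... | u , j , child≢u = ≤-reflexive (begin-equality
            z e ≈⟨ 4*[½*[½*x]]≈x (z e) ⟨
            fromℕ 4 * (½ * (½ * z e)) ≈⟨ *-congˡ (average-when-∉-∈ child≢u (z e)) ⟨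
            fromℕ 4 * average n (λ A → when (child e ∉ˢ A × u ∈ˢ A) (z e))
              ≈⟨ *-congˡ (average-cong n λ A → reflexive (when-cong
                   (λ (c∉A , u∈A) → e∈F , c∉A , u , j , u∈A) (λ (_ , cut) → proj₁ cut , other∈ A cut) (z e))) ⟩
            fromℕ 4 * average n (λ A → when (P A e) (z e)) ∎)
            where
            -- The cut edge carries its own witness for the other end; since `e` is not a loop, that
            -- end is `u`.
            other∈ : ∀ A → Cut.CutEdge A (T A) (q A) (child e) e → u ∈ˢ A
            other∈ A (_ , u′ , j′ , u′∈A) with Joins-unique j j′
            ... | inj₁ (_ , u′≡u) = ≡.subst (_∈ˢ A) u′≡u u′∈A
            ... | inj₂ (c≡u , _)  = contradiction c≡u child≢u

      opt≤bound : ∀ {ω s K} → 0# ≤ K → K ≤ N · δ → s ≤ K → s ≤ opt ω → s ≤ bound ω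
      -- The implication from `s ≤ x` to `s ≤ bound ω` holds at `x = 0#` and at every forest weight,
      -- hence at their maximum.
      opt≤bound {ω} {s} {K} 0≤K K≤Nδ s≤K = Extrema.argmax-all totalOrder id {P = λ x → s ≤ x → s ≤ bound ω}
        (λ s≤0 → ≤-trans s≤0 (bound-nonNeg ω))
        (All.map⁺ (All.map (λ forest → forest≤bound forest 0≤K K≤Nδ s≤K)
          (All.all-filter (λ F → em {P = Forest F}) (subsets m))))

      integral-bound : HasIntegral bound (fromℕ 4 * average n D.upperMean)
      integral-bound = integral-* (fromℕ-nonNeg 4) (integral-average n D.integral-upper)

      averageUpper≤ : fromℕ 4 * average n D.upperMean ≤ fromℕ 8 * average n D.lowerMean + fromℕ 4 * fromℕ n * δ
      averageUpper≤ = begin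
        fromℕ 4 * average n D.upperMean
          ≤⟨ *-monoˡ-≤ (fromℕ-nonNeg 4) (average-mono n D.upperMean≤) ⟩
        fromℕ 4 * average n (λ A → (D.lowerMean A + D.lowerMean A) + fromℕ n * δ)
          ≈⟨ *-congˡ (trans (average-+ n _ _) (+-cong (average-+ n _ _) (average-const n _))) ⟩
        fromℕ 4 * ((average n D.lowerMean + average n D.lowerMean) + fromℕ n * δ)
          ≈⟨ solve 3 (λ a b d → lit 4 :* ((a :+ a) :+ b :* d) := lit 8 :* a :+ lit 4 :* b :* d) refl
               (average n D.lowerMean) (fromℕ n) δ ⟩
        fromℕ 8 * average n D.lowerMean + fromℕ 4 * fromℕ n * δ ∎

    𝔼[OPT]≤8𝔼[ALG] : 𝔼[OPT] ≤⁺ fromℕ 8 ·⁺ 𝔼[ALG] T q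
    𝔼[OPT]≤8𝔼[ALG] = 𝔼≤ opt-nonNeg λ s s≤opt →
      -- `K` depends on `s` alone and `N` is chosen after `δ`. The error coefficient `4 n` depends
      -- on none of them, so the error vanishes with `δ`.
      let (K , 0≤K , s≤K) = simple-bounded s in
      ≤⁺-byEpsilon (*-nonNeg (fromℕ-nonNeg 4) (fromℕ-nonNeg n)) λ δ 0<δ →
        let (N , K≤Nδ) = archimedean 0<δ K
            open Approximation δ 0<δ N
        in fromℕ 8 * average n D.lowerMean
         , ≤⁺-·⁺ (fromℕ-nonNeg 8) (average≤𝔼-subset n λ A → ≤𝔼 (D.integral-lower A) (D.lower≤alg A))
         , ≤-trans (integral-mono (record { simple = s ; value≈ = λ _ → refl ; integral≈ = refl }) integral-bound
                     (λ ω → opt≤bound 0≤K K≤Nδ (s≤K ω) (s≤opt ω)))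
                   averageUpper≤
      where
      opt-nonNeg : ∀ ω → 0# ≤ opt ω
      opt-nonNeg ω = Extrema.f[⊥]≤f[argmax] totalOrder {f = id} 0#
        (List.map (λ F → weight F ω) (List.filter (λ F → em {P = Forest F}) (subsets m)))

theorem4p4 : (em : ∀ {ℓ} → ExcludedMiddle ℓ)
  (ℝ : CompleteOrderedField) (𝒫 : ProbabilitySpace ℝ)
  {n m : ℕ} (I : ProphetInstance ℝ 𝒫 n m) →
  let open CompleteOrderedField ℝ
      open Prophet em ℝ 𝒫 I
  in (T : Subset n → Fin n → Carrier) (q : Subset n → Fin m → Carrier) →
     (∀ A → MedianThresholds A (T A) (q A)) →
     𝔼[OPT] ≤⁺ fromℕ 8 ·⁺ 𝔼[ALG] T q
theorem4p4 em ℝ 𝒫 I = RandomCut.Competitive.𝔼[OPT]≤8𝔼[ALG] em ℝ 𝒫 I
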